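{- There are positive constants $n_0$ and $c$ such that for all positive integers $n$, if $n\ge n_0$ then $m(n,n-1)\le c^{\sqrt{\ln n}}$.
   Context: A hypergraph is an ordered pair $(X,H)$ such that $X$ is a set and $H$ is a family of subsets of $X$; elements of $X$ are its vertices and members of $H$ are its edges (edges may have arbitrary sizes). For any two distinct vertices $u,v$ of a hypergraph $(X,H)$, the line $\overline{uv}$ is the set $\{u,v\}\cup\{p\in X:\ \exists\, T\in H \text{ with } \{u,v,p\}\subseteq T\}$. The lines of the hypergraph are all the sets $\overline{uv}$ with $u,v$ distinct vertices; the number of lines is the number of distinct such sets. For integers $n,k$, $m(n,k)$ denotes the smallest number of (distinct) lines in a hypergraph on $n$ vertices where every line consists of at most $k$ vertices. $\ln$ denotes the natural logarithm. -}

module Defs where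

open import Data.Nat.Base as ℕ using (ℕ; zero; suc)
import Data.Nat.Properties as ℕ
open import Data.Integer.Base as ℤ using (-[1+_])
import Data.Integer.Properties as ℤ
open import Data.Rational.Base
open import Data.Rational.Properties
import Data.Rational.Unnormalised.Base as ℚᵘ
import Data.Rational.Unnormalised.Properties as ℚᵘ
open import Data.Rational.Solver using (module +-*-Solver)
import Data.Bool.Properties as Bool
open import Data.Fin.Base using (Fin)
import Data.Fin.Properties as Fin
import Data.Fin.Subset as Subset
import Data.Fin.Subset.Properties as Subset
open import Data.List.Base using (List; length; map; filter; deduplicate; allFin; cartesianProduct)
open import Data.List.Relation.Unary.Any using (Any; any?)
open import Data.Vec.Base using (tabulate)
import Data.Vec.Properties as Vec
open import Data.Product.Base using (∃; ∃-syntax; _×_; _,_; proj₁; proj₂; uncurry)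
open import Data.Sum.Base using (_⊎_; inj₁; inj₂)
open import Data.Empty using (⊥; ⊥-elim)
open import Algebra.Bundles using (CommutativeRing)
open import Algebra.Properties.CommutativeSemiring.Exp
  (CommutativeRing.commutativeSemiring +-*-commutativeRing)
  using (_^_; ^-assocʳ; ^-distrib-*)
open import Relation.Binary.Definitions using (DecidableEquality; tri<; tri≈; tri>)
open import Relation.Binary.PropositionalEquality
  using (_≡_; _≢_; refl; sym; trans; cong; subst; subst₂)
open import Relation.Nullary using (Dec; yes; no; does; ¬?; _×-dec_; _⊎-dec_)
open import Relation.Unary using (Decidable)
open +-*-Solver using (solve; _:=_; _:+_; _:*_; :-_; _:-_; con)

-- A hypergraph on the vertex set Fin n, given by its edges. Order and repetition
-- in the list are immaterial: lines only depend on which subsets are edges.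
Hypergraph : ℕ → Set
Hypergraph n = List (Subset.Subset n)

module _ {n : ℕ} (H : Hypergraph n) where

  OnLine : Fin n → Fin n → Fin n → Set
  OnLine u v p = (p ≡ u ⊎ p ≡ v) ⊎ Any (λ T → u Subset.∈ T × v Subset.∈ T × p Subset.∈ T) H

  onLine? : ∀ u v → Decidable (OnLine u v)
  onLine? u v p = (p Fin.≟ u ⊎-dec p Fin.≟ v) ⊎-dec
    any? (λ T → u Subset.∈? T ×-dec v Subset.∈? T ×-dec p Subset.∈? T) H

  line : Fin n → Fin n → Subset.Subset n
  line u v = tabulate (λ p → does (onLine? u v p))

  lines : List (Subset.Subset n)
  lines = deduplicate (Vec.≡-dec Bool._≟_)
    (map (uncurry line)
      (filter (λ (u , v) → ¬? (u Fin.≟ v)) (cartesianProduct (allFin n) (allFin n))))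

  numberOfLines : ℕ
  numberOfLines = length lines

  LinesHaveAtMost : ℕ → Set
  LinesHaveAtMost k = ∀ u v → u ≢ v → Subset.∣ line u v ∣ ℕ.≤ k

-- m(n,k) is only a partial function (no hypergraph on 2 vertices has all its lines
-- of size at most 1), so it is rendered by its graph.
m[_,_]≡_ : ℕ → ℕ → ℕ → Set
m[ n , k ]≡ ℓ =
  (∃[ H ] LinesHaveAtMost {n} H k × numberOfLines H ≡ ℓ) ×
  (∀ H → LinesHaveAtMost {n} H k → ℓ ℕ.≤ numberOfLines H)

0<q-p : ∀ {p q} → p < q → 0ℚ < q - p
0<q-p {p} {q} p<q = subst (_< q - p) (+-inverseʳ p) (+-monoˡ-< (- p) p<q)

0<q-p⇒p<q : ∀ {p q} → 0ℚ < q - p → p < q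
0<q-p⇒p<q {p} {q} h = subst₂ _<_ (+-identityˡ p)
  (solve 2 (λ q p → q :- p :+ p := q) refl q p) (+-monoˡ-< p h)

0≤q-p : ∀ {p q} → p ≤ q → 0ℚ ≤ q - p
0≤q-p {p} {q} p≤q = subst (_≤ q - p) (+-inverseʳ p) (+-monoˡ-≤ (- p) p≤q)

0≤q-p⇒p≤q : ∀ {p q} → 0ℚ ≤ q - p → p ≤ q
0≤q-p⇒p≤q {p} {q} h = subst₂ _≤_ (+-identityˡ p)
  (solve 2 (λ q p → q :- p :+ p := q) refl q p) (+-monoˡ-≤ p h)

0<+ : ∀ {p q} → 0ℚ < p → 0ℚ < q → 0ℚ < p + q
0<+ = +-mono-<

0<+0≤ : ∀ {p q} → 0ℚ < p → 0ℚ ≤ q → 0ℚ < p + q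
0<+0≤ = +-mono-<-≤

0≤+ : ∀ {p q} → 0ℚ ≤ p → 0ℚ ≤ q → 0ℚ ≤ p + q
0≤+ = +-mono-≤

*ʳ-< : ∀ {p q r} → 0ℚ < r → p < q → p * r < q * r
*ʳ-< {r = r} 0<r = *-monoˡ-<-pos r {{positive 0<r}}

*ˡ-< : ∀ {p q r} → 0ℚ < r → p < q → r * p < r * q
*ˡ-< {r = r} 0<r = *-monoʳ-<-pos r {{positive 0<r}}

*ʳ-≤ : ∀ {p q r} → 0ℚ ≤ r → p ≤ q → p * r ≤ q * r
*ʳ-≤ {r = r} 0≤r = *-monoʳ-≤-nonNeg r {{nonNegative 0≤r}}

*ˡ-≤ : ∀ {p q r} → 0ℚ ≤ r → p ≤ q → r * p ≤ r * q
*ˡ-≤ {r = r} 0≤r = *-monoˡ-≤-nonNeg r {{nonNegative 0≤r}}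

*-cancelʳ-< : ∀ {p q r} → 0ℚ < r → p * r < q * r → p < q
*-cancelʳ-< {r = r} 0<r = *-cancelʳ-<-nonNeg r {{nonNegative (<⇒≤ 0<r)}}

0<* : ∀ {p q} → 0ℚ < p → 0ℚ < q → 0ℚ < p * q
0<* {p} {q} 0<p 0<q = subst (_< p * q) (*-zeroˡ q) (*ʳ-< 0<q 0<p)

0≤* : ∀ {p q} → 0ℚ ≤ p → 0ℚ ≤ q → 0ℚ ≤ p * q
0≤* {p} {q} 0≤p 0≤q = subst (_≤ p * q) (*-zeroˡ q) (*ʳ-≤ 0≤q 0≤p)

neg-flip : ∀ {p} → p ≤ 0ℚ → 0ℚ ≤ - p
neg-flip = neg-antimono-≤

0≤p² : ∀ p → 0ℚ ≤ p * p
0≤p² p with ≤-total 0ℚ p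
... | inj₁ 0≤p = 0≤* 0≤p 0≤p
... | inj₂ p≤0 = subst (0ℚ ≤_)
  (solve 1 (λ p → (:- p) :* (:- p) := p :* p) refl p)
  (0≤* (neg-flip p≤0) (neg-flip p≤0))

0<1 : 0ℚ < 1ℚ
0<1 = *<* (ℤ.+<+ (ℕ.s≤s ℕ.z≤n))

inverse : ∀ {p} → 0ℚ < p → ∃[ r ] (0ℚ < r × r * p ≡ 1ℚ)
inverse {p} 0<p = r , 0<r , *-inverseˡ p
  where
  instance
    p-pos : Positive p
    p-pos = positive 0<p
    p-nonZero : NonZero p
    p-nonZero = pos⇒nonZero p
  r : ℚ
  r = 1/ p
  0<r : 0ℚ < r
  0<r = positive⁻¹ r {{1/pos⇒pos p}}

ι : ℕ → ℚ
ι k = ℤ.+ k / 1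

recip : ℕ → ℚ
recip k = ℤ.+ 1 / suc k

ι-suc : ∀ k → ι (suc k) ≡ 1ℚ + ι k
ι-suc k = toℚᵘ-injective (begin
  toℚᵘ (ι (suc k))                    ≈⟨ toℚᵘ-fromℚᵘ (ℚᵘ.mkℚᵘ (ℤ.+ suc k) 0) ⟩
  ℚᵘ.mkℚᵘ (ℤ.+ suc k) 0                 ≈⟨ ℚᵘ.*≡* (cong (λ z → (ℤ.+ 1 ℤ.+ z) ℤ.* ℤ.+ 1) (ℤ.*-identityʳ (ℤ.+ k))) ⟨
  ℚᵘ.1ℚᵘ ℚᵘ.+ ℚᵘ.mkℚᵘ (ℤ.+ k) 0         ≈⟨ ℚᵘ.+-congʳ ℚᵘ.1ℚᵘ (toℚᵘ-fromℚᵘ (ℚᵘ.mkℚᵘ (ℤ.+ k) 0)) ⟨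
  ℚᵘ.1ℚᵘ ℚᵘ.+ toℚᵘ (ι k)              ≈⟨ toℚᵘ-homo-+ 1ℚ (ι k) ⟨
  toℚᵘ (1ℚ + ι k)                     ∎)
  where open ℚᵘ.≃-Reasoning

ι*recip : ∀ k → ι (suc k) * recip k ≡ 1ℚ
ι*recip k = toℚᵘ-injective (begin
  toℚᵘ (ι (suc k) * recip k)          ≈⟨ toℚᵘ-homo-* (ι (suc k)) (recip k) ⟩
  toℚᵘ (ι (suc k)) ℚᵘ.* toℚᵘ (recip k) ≈⟨ ℚᵘ.*-cong (toℚᵘ-fromℚᵘ (ℚᵘ.mkℚᵘ (ℤ.+ suc k) 0)) (toℚᵘ-fromℚᵘ (ℚᵘ.mkℚᵘ (ℤ.+ 1) k)) ⟩
  ℚᵘ.mkℚᵘ (ℤ.+ suc k) 0 ℚᵘ.* ℚᵘ.mkℚᵘ (ℤ.+ 1) k ≈⟨ ℚᵘ.*≡* (cong ℤ.+_ (cong suc lem)) ⟩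
  ℚᵘ.1ℚᵘ                              ∎)
  where
  open ℚᵘ.≃-Reasoning
  lem : k ℕ.* 1 ℕ.* 1 ≡ k ℕ.+ 0 ℕ.+ 0
  lem = trans (trans (ℕ.*-identityʳ _) (ℕ.*-identityʳ k))
              (sym (trans (ℕ.+-identityʳ _) (ℕ.+-identityʳ k)))

0≤ι : ∀ k → 0ℚ ≤ ι k
0≤ι zero    = ≤-refl
0≤ι (suc k) = subst (0ℚ ≤_) (sym (ι-suc k)) (0≤+ (<⇒≤ 0<1) (0≤ι k))

0<ιsuc : ∀ k → 0ℚ < ι (suc k)
0<ιsuc k = subst (0ℚ <_) (sym (ι-suc k)) (0<+0≤ 0<1 (0≤ι k))

0<recip : ∀ k → 0ℚ < recip k
0<recip k = *-cancelʳ-< (0<ιsuc k) (subst₂ _<_ (sym (*-zeroˡ (ι (suc k))))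
  (sym (trans (*-comm (recip k) _) (ι*recip k))) 0<1)

archimedean : ∀ p → ∃[ k ] (p < ι (suc k))
archimedean p@(mkℚ n d-1 _) = ℤ.∣ n ∣ , toℚᵘ-cancel-<
  (ℚᵘ.<-respʳ-≃ (ℚᵘ.≃-sym (toℚᵘ-fromℚᵘ (ℚᵘ.mkℚᵘ (ℤ.+ suc ℤ.∣ n ∣) 0))) (ℚᵘ.*<* (bound n)))
  where
  bound : ∀ m → m ℤ.* ℤ.+ 1 ℤ.< ℤ.+ suc ℤ.∣ m ∣ ℤ.* ℤ.+ suc d-1
  bound (ℤ.+ m) = subst (ℤ._< ℤ.+ suc m ℤ.* ℤ.+ suc d-1) (sym (ℤ.*-identityʳ (ℤ.+ m)))
    (ℤ.+<+ (ℕ.≤-trans (ℕ.n<1+n m) (ℕ.m≤m*n (suc m) (suc d-1))))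
  bound -[1+ m ] = ℤ.-<+

small : ∀ p {δ} → 0ℚ < δ → ∃[ k ] (p * recip k < δ)
small p {δ} 0<δ with inverse 0<δ
... | i , 0<i , i*δ≡1 with archimedean (p * i)
...   | k , pi<k = k , *-cancelʳ-< (0<* 0<i (0<ιsuc k))
  (subst₂ _<_ lhs rhs pi<k)
  where
  lhs : p * i ≡ p * recip k * (i * ι (suc k))
  lhs = sym (trans
    (solve 4 (λ p r i m → p :* r :* (i :* m) := p :* i :* (m :* r)) refl p (recip k) i (ι (suc k)))
    (trans (cong (p * i *_) (ι*recip k)) (*-identityʳ _)))
  rhs : ι (suc k) ≡ δ * (i * ι (suc k))
  rhs = sym (trans
    (solve 3 (λ d i m → d :* (i :* m) := (i :* d) :* m) refl δ i (ι (suc k)))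
    (trans (cong (_* ι (suc k)) i*δ≡1) (*-identityˡ _)))

below : ∀ p → ∃[ q ] (q < p)
below p = p - 1ℚ , 0<q-p⇒p<q (subst (0ℚ <_)
  (solve 1 (λ p → con 1ℚ := p :- (p :- con 1ℚ)) refl p) 0<1)

above : ∀ p → ∃[ q ] (p < q)
above p = p + 1ℚ , 0<q-p⇒p<q (subst (0ℚ <_)
  (solve 1 (λ p → con 1ℚ := p :+ con 1ℚ :- p) refl p) 0<1)

^-pos : ∀ {p} n → 0ℚ < p → 0ℚ < p ^ n
^-pos zero    0<p = 0<1
^-pos (suc n) 0<p = 0<* 0<p (^-pos n 0<p)

^-mono : ∀ {p q} n → 0ℚ < p → p ≤ q → p ^ n ≤ q ^ n
^-mono zero    0<p p≤q = ≤-refl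
^-mono (suc n) 0<p p≤q = ≤-trans
  (*ʳ-≤ (<⇒≤ (^-pos n 0<p)) p≤q)
  (*ˡ-≤ (≤-trans (<⇒≤ 0<p) p≤q) (^-mono n 0<p p≤q))

1^ : ∀ n → 1ℚ ^ n ≡ 1ℚ
1^ zero    = refl
1^ (suc n) = trans (*-identityˡ _) (1^ n)

bernoulli : ∀ n {h} → 0ℚ ≤ 1ℚ + h → 1ℚ + ι n * h ≤ (1ℚ + h) ^ n
bernoulli zero {h} _ = ≤-reflexive
  (trans (cong (1ℚ +_) (*-zeroˡ h)) (+-identityʳ 1ℚ))
bernoulli (suc n) {h} 0≤1+h = ≤-trans step (*ˡ-≤ 0≤1+h (bernoulli n 0≤1+h))
  where
  step : 1ℚ + ι (suc n) * h ≤ (1ℚ + h) * (1ℚ + ι n * h)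
  step = 0≤q-p⇒p≤q (subst (0ℚ ≤_)
    (trans
      (solve 2 (λ m h → m :* (h :* h)
         := (con 1ℚ :+ h) :* (con 1ℚ :+ m :* h) :- (con 1ℚ :+ (con 1ℚ :+ m) :* h))
         refl (ι n) h)
      (cong (λ m → (1ℚ + h) * (1ℚ + ι n * h) - (1ℚ + m * h)) (sym (ι-suc n))))
    (0≤* (0≤ι n) (0≤p² h)))

-- exp p is cut out by the classical bounds (1 + p/K)^K ≤ exp p ≤ (1 - p/K)^(-K),
-- valid as soon as the bases are positive; here K = 1 + k. Both bounds converge to
-- exp p as K grows. The upper bound is kept in the division-free form 1 < q (1 - p/K)^K.
lowerBase upperBase : ℚ → ℕ → ℚ
lowerBase p k = 1ℚ + p * recip k
upperBase p k = 1ℚ - p * recip k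

_<exp_ : ℚ → ℚ → Set
q <exp p = ∃[ k ] (0ℚ < lowerBase p k × q < lowerBase p k ^ suc k)

_exp<_ : ℚ → ℚ → Set
p exp< q = ∃[ k ] (0ℚ < upperBase p k × 1ℚ < q * upperBase p k ^ suc k)

refine : ∀ m {x y} → ι (suc m) * y ≡ x → 0ℚ < 1ℚ + x →
         0ℚ < 1ℚ + y × 1ℚ + x ≤ (1ℚ + y) ^ suc m
refine m {x} {y} refl 0<1+x = 0<1+y , bernoulli (suc m) (<⇒≤ 0<1+y)
  where
  0<1+y : 0ℚ < 1ℚ + y
  0<1+y = *-cancelʳ-< (0<ιsuc m) (subst₂ _<_ (sym (*-zeroˡ (ι (suc m))))
    (trans (cong (λ z → 1ℚ + z * y + ι m) (ι-suc m))
      (trans (solve 2 (λ m y → con 1ℚ :+ (con 1ℚ :+ m) :* y :+ m := (con 1ℚ :+ y) :* (con 1ℚ :+ m))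
               refl (ι m) y)
             (cong ((1ℚ + y) *_) (sym (ι-suc m)))))
    (0<+0≤ 0<1+x (0≤ι m)))

exp-sep : ∀ {p p' a b} → p ≤ p' → a <exp p → p' exp< b → a < b
exp-sep {p} {p'} {a} {b} p≤p' (k , 0<A , a<Aᵏ) (l , 0<B , 1<bBˡ) =
  *-cancelʳ-< (^-pos (suc l) 0<B)
    (<-trans (<-≤-trans (*ʳ-< (^-pos (suc l) 0<B) a<Aᵏ) AB≤1) 1<bBˡ)
  where
  A = lowerBase p k
  B = upperBase p' l
  h = recip k * recip l

  0≤h : 0ℚ ≤ h
  0≤h = 0≤* (<⇒≤ (0<recip k)) (<⇒≤ (0<recip l))

  A-refined = refine l {p * recip k} {p * h}
    (trans (solve 4 (λ p m r s → m :* (p :* (r :* s)) := (p :* r) :* (m :* s)) refl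
             p (ι (suc l)) (recip k) (recip l))
      (trans (cong (p * recip k *_) (ι*recip l)) (*-identityʳ _)))
    0<A
  B-refined = refine k { - (p' * recip l)} { - (p' * h)}
    (trans (solve 4 (λ p m r s → m :* (:- (p :* (r :* s))) := (:- (p :* s)) :* (m :* r)) refl
             p' (ι (suc k)) (recip k) (recip l))
      (trans (cong (- (p' * recip l) *_) (ι*recip k)) (*-identityʳ _)))
    0<B

  u = 1ℚ + p * h
  v = 1ℚ - p' * h
  0<u = proj₁ A-refined
  0<v = proj₁ B-refined
  N = suc k ℕ.* suc l

  A≤uᴺ : A ^ suc k ≤ u ^ N
  A≤uᴺ = ≤-trans (^-mono (suc k) 0<A (proj₂ A-refined))
    (≤-reflexive (trans (^-assocʳ u (suc l) (suc k)) (cong (u ^_) (ℕ.*-comm (suc l) (suc k)))))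

  B≤vᴺ : B ^ suc l ≤ v ^ N
  B≤vᴺ = ≤-trans (^-mono (suc l) 0<B (proj₂ B-refined))
    (≤-reflexive (^-assocʳ v (suc k) (suc l)))

  uv≤1 : u * v ≤ 1ℚ
  uv≤1 = ≤-trans
    (*ʳ-≤ (<⇒≤ 0<v) (+-monoʳ-≤ 1ℚ (*ʳ-≤ 0≤h p≤p')))
    (0≤q-p⇒p≤q (subst (0ℚ ≤_)
      (solve 1 (λ x → x :* x := con 1ℚ :- (con 1ℚ :+ x) :* (con 1ℚ :- x)) refl (p' * h))
      (0≤p² (p' * h))))

  AB≤1 : A ^ suc k * B ^ suc l ≤ 1ℚ
  AB≤1 = ≤-trans (*ʳ-≤ (<⇒≤ (^-pos (suc l) 0<B)) A≤uᴺ)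
    (≤-trans (*ˡ-≤ (<⇒≤ (^-pos N 0<u)) B≤vᴺ)
      (≤-trans (≤-reflexive (sym (^-distrib-* u v N)))
        (≤-trans (^-mono N (0<* 0<u 0<v) uv≤1) (≤-reflexive (1^ N)))))

scale-pos : ∀ {x} k → - x < ι (suc k) → 0ℚ < 1ℚ + x * recip k
scale-pos {x} k -x<k = *-cancelʳ-< (0<ιsuc k) (subst₂ _<_ (sym (*-zeroˡ (ι (suc k))))
  (sym (trans
    (solve 3 (λ x r m → (con 1ℚ :+ x :* r) :* m := m :- (:- x) :* (m :* r)) refl x (recip k) (ι (suc k)))
    (cong (λ z → ι (suc k) - z) (trans (cong (- x *_) (ι*recip k)) (*-identityʳ (- x))))))
  (0<q-p -x<k))

recip-anti : ∀ {j k} → ι (suc j) ≤ ι (suc k) → recip k ≤ recip j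
recip-anti {j} {k} j≤k = subst₂ _≤_
  (trans (solve 3 (λ m r s → m :* (r :* s) := s :* (m :* r)) refl (ι (suc j)) (recip j) (recip k))
    (trans (cong (recip k *_) (ι*recip j)) (*-identityʳ _)))
  (trans (solve 3 (λ m r s → m :* (r :* s) := r :* (m :* s)) refl (ι (suc k)) (recip j) (recip k))
    (trans (cong (recip j *_) (ι*recip k)) (*-identityʳ _)))
  (*ʳ-≤ (0≤* (<⇒≤ (0<recip j)) (<⇒≤ (0<recip k))) j≤k)

ι-mono : ∀ {j k} → j ℕ.≤ k → ι j ≤ ι k
ι-mono {k = k} ℕ.z≤n = 0≤ι k
ι-mono {suc j} {suc k} (ℕ.s≤s j≤k) = subst₂ _≤_ (sym (ι-suc j)) (sym (ι-suc k))
  (+-monoʳ-≤ 1ℚ (ι-mono j≤k))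

<-ι-mono : ∀ {p j k} → j ℕ.≤ k → p < ι (suc j) → p < ι (suc k)
<-ι-mono j≤k p<j = <-≤-trans p<j (ι-mono (ℕ.s≤s j≤k))

p≤∣p∣ : ∀ p → p ≤ ∣ p ∣
p≤∣p∣ p with ≤-total 0ℚ p
... | inj₁ 0≤p = ≤-reflexive (sym (0≤p⇒∣p∣≡p 0≤p))
... | inj₂ p≤0 = ≤-trans p≤0 (0≤∣p∣ p)

bases-gap : ∀ p p' k {θ} → 0ℚ < lowerBase p k → 0ℚ < upperBase p' k →
  p * p' * recip k < 1ℚ + p - p' - θ →
  θ < lowerBase p k ^ suc k * upperBase p' k ^ suc k
bases-gap p p' k {θ} 0<A 0<B error = <-≤-trans θ<1+Kg
  (≤-trans (bernoulli (suc k) (subst (0ℚ ≤_) AB≡1+g (<⇒≤ (0<* 0<A 0<B))))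
    (≤-reflexive (trans (cong (_^ suc k) (sym AB≡1+g))
      (^-distrib-* (lowerBase p k) (upperBase p' k) (suc k)))))
  where
  g : ℚ
  g = - ((p' - p) * recip k) - p * p' * recip k * recip k

  AB≡1+g : lowerBase p k * upperBase p' k ≡ 1ℚ + g
  AB≡1+g = solve 3 (λ p p' r → (con 1ℚ :+ p :* r) :* (con 1ℚ :- p' :* r)
    := con 1ℚ :+ ((:- ((p' :- p) :* r)) :- p :* p' :* r :* r)) refl p p' (recip k)

  Kg : ι (suc k) * g ≡ (p - p') - p * p' * recip k
  Kg = trans
    (solve 4 (λ p p' r m → m :* ((:- ((p' :- p) :* r)) :- p :* p' :* r :* r)
      := ((p :- p') :- p :* p' :* r) :* (m :* r)) refl p p' (recip k) (ι (suc k)))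
    (trans (cong (((p - p') - p * p' * recip k) *_) (ι*recip k)) (*-identityʳ _))

  θ<1+Kg : θ < 1ℚ + ι (suc k) * g
  θ<1+Kg = 0<q-p⇒p<q (subst (0ℚ <_)
    (trans
      (solve 4 (λ p p' θ e → con 1ℚ :+ p :- p' :- θ :- e := con 1ℚ :+ ((p :- p') :- e) :- θ)
        refl p p' θ (p * p' * recip k))
      (cong (λ z → 1ℚ + z - θ) (sym Kg)))
    (0<q-p error))

-- As K grows, (1 + p/K)^K (1 - p'/K)^K eventually exceeds any θ < 1 + p - p'.
exp-approx : ∀ p p' {θ} → θ < 1ℚ + p - p' →
  ∃[ k ] (0ℚ < lowerBase p k × 0ℚ < upperBase p' k ×
          θ < lowerBase p k ^ suc k * upperBase p' k ^ suc k)
exp-approx p p' {θ} θ< = k , 0<A , 0<B , bases-gap p p' k 0<A 0<B error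
  where
  find-i : ∃[ k ] (- p < ι (suc k))
  find-i = archimedean (- p)
  find-j : ∃[ k ] (- (- p') < ι (suc k))
  find-j = archimedean (- (- p'))
  find-l : ∃[ k ] (∣ p * p' ∣ * recip k < 1ℚ + p - p' - θ)
  find-l = small ∣ p * p' ∣ (0<q-p θ<)
  i j l : ℕ
  i = proj₁ find-i
  j = proj₁ find-j
  l = proj₁ find-l
  k : ℕ
  k = i ℕ.+ j ℕ.+ l
  i≤k : i ℕ.≤ k
  i≤k = ℕ.≤-trans (ℕ.m≤m+n i j) (ℕ.m≤m+n (i ℕ.+ j) l)
  j≤k : j ℕ.≤ k
  j≤k = ℕ.≤-trans (ℕ.m≤n+m j i) (ℕ.m≤m+n (i ℕ.+ j) l)
  l≤k : l ℕ.≤ k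
  l≤k = ℕ.m≤n+m l (i ℕ.+ j)

  0<A : 0ℚ < lowerBase p k
  0<A = scale-pos k (<-ι-mono i≤k (proj₂ find-i))
  0<B : 0ℚ < upperBase p' k
  0<B = subst (λ z → 0ℚ < 1ℚ + z) (sym (neg-distribˡ-* p' (recip k)))
    (scale-pos k (<-ι-mono j≤k (proj₂ find-j)))

  error : p * p' * recip k < 1ℚ + p - p' - θ
  error = ≤-<-trans (≤-trans (*ʳ-≤ (<⇒≤ (0<recip k)) (p≤∣p∣ (p * p')))
    (*ˡ-≤ (0≤∣p∣ (p * p')) (recip-anti {l} {k} (ι-mono (ℕ.s≤s l≤k))))) (proj₂ find-l)

-- Dedekind reals: two-sided cuts of ℚ, open on both sides.
record ℝ : Set₁ where
  field
    lower upper     : ℚ → Set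
    lower-inhabited : ∃ lower
    upper-inhabited : ∃ upper
    lower-down      : ∀ {p q} → p < q → lower q → lower p
    upper-up        : ∀ {p q} → p < q → upper p → upper q
    lower-open      : ∀ {p} → lower p → ∃[ q ] (p < q × lower q)
    upper-open      : ∀ {q} → upper q → ∃[ p ] (p < q × upper p)
    disjoint        : ∀ {q} → lower q → upper q → ⊥
    located         : ∀ {p q} → p < q → lower p ⊎ upper q

open ℝ

infix 4 _<ℝ_ _≤ℝ_

_<ℝ_ : ℝ → ℝ → Set
x <ℝ y = ∃[ q ] (upper x q × lower y q)

_≤ℝ_ : ℝ → ℝ → Set
x ≤ℝ y = ∀ q → lower x q → lower y q

fromℚ : ℚ → ℝ
fromℚ r = record
  { lower           = _< r
  ; upper           = r <_
  ; lower-inhabited = below r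
  ; upper-inhabited = above r
  ; lower-down      = <-trans
  ; upper-up        = λ p<q r<p → <-trans r<p p<q
  ; lower-open      = <-dense
  ; upper-open      = λ r<q → let p , r<p , p<q = <-dense r<q in p , p<q , r<p
  ; disjoint        = <-asym
  ; located         = locate
  }
  where
  locate : ∀ {p q} → p < q → p < r ⊎ r < q
  locate {p} {q} p<q with p <? r
  ... | yes p<r = inj₁ p<r
  ... | no  p≮r = inj₂ (≤-<-trans (≮⇒≥ p≮r) p<q)

fromℕ : ℕ → ℝ
fromℕ n = fromℚ (ι n)

0ℝ : ℝ
0ℝ = fromℚ 0ℚ

ℝ⁺ : Set₁
ℝ⁺ = ∃[ x ] 0ℝ <ℝ x

fromℕ⁺ : ∀ n → .{{ℕ.NonZero n}} → ℝ⁺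
fromℕ⁺ n@(suc k) = fromℕ n , <-dense (0<ιsuc k)

lower<upper : ∀ x {p q} → lower x p → upper x q → p < q
lower<upper x {p} {q} p<x x<q with p <? q
... | yes p<q = p<q
... | no  p≮q with <-cmp p q
...   | tri< p<q _ _    = p<q
...   | tri≈ _ refl _   = ⊥-elim (disjoint x p<x x<q)
...   | tri> _ _ q<p    = ⊥-elim (disjoint x (lower-down x q<p p<x) x<q)

Within : ℝ → ℚ → Set
Within x δ = ∃[ a ] ∃[ b ] (lower x a × upper x b × b < a + δ)

scan : ∀ x {h δ} → 0ℚ < h → h + h < δ →
       ∀ n a → lower x a → upper x (a + ι n * h) → Within x δ
scan x {h} 0<h 2h<δ zero a a<x x<b =
  ⊥-elim (disjoint x a<x (subst (upper x) (trans (cong (a +_) (*-zeroˡ h)) (+-identityʳ a)) x<b))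
scan x {h} {δ} 0<h 2h<δ (suc n) a a<x x<b = step (located x a+h<a+2h)
  where
  a+h<a+2h : a + h < a + (h + h)
  a+h<a+2h = 0<q-p⇒p<q (subst (0ℚ <_)
    (solve 2 (λ a h → h := a :+ (h :+ h) :- (a :+ h)) refl a h) 0<h)
  end : a + ι (suc n) * h ≡ a + h + ι n * h
  end = trans (cong (λ z → a + z * h) (ι-suc n))
    (solve 3 (λ a m h → a :+ (con 1ℚ :+ m) :* h := a :+ h :+ m :* h) refl a (ι n) h)
  step : lower x (a + h) ⊎ upper x (a + (h + h)) → Within x δ
  step (inj₁ a+h<x)  = scan x 0<h 2h<δ n (a + h) a+h<x (subst (upper x) end x<b)
  step (inj₂ x<a+2h) = a , a + (h + h) , a<x , x<a+2h , +-monoʳ-< a 2h<δ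

approximate : ∀ x {δ} → 0ℚ < δ → Within x δ
approximate x {δ} 0<δ = scan x (0<recip k) 2h<δ (suc n) a₀ (proj₂ (lower-inhabited x)) x<end
  where
  a₀ b₀ : ℚ
  a₀ = proj₁ (lower-inhabited x)
  b₀ = proj₁ (upper-inhabited x)
  find-k : ∃[ k ] ((1ℚ + 1ℚ) * recip k < δ)
  find-k = small (1ℚ + 1ℚ) 0<δ
  k : ℕ
  k = proj₁ find-k
  find-n : ∃[ n ] ((b₀ - a₀) * ι (suc k) < ι (suc n))
  find-n = archimedean ((b₀ - a₀) * ι (suc k))
  n : ℕ
  n = proj₁ find-n
  2h<δ : recip k + recip k < δ
  2h<δ = subst (_< δ) (solve 1 (λ h → (con 1ℚ :+ con 1ℚ) :* h := h :+ h) refl (recip k)) (proj₂ find-k)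
  lem : (b₀ - a₀) * ι (suc k) * recip k ≡ b₀ - a₀
  lem = trans (*-assoc (b₀ - a₀) (ι (suc k)) (recip k))
    (trans (cong ((b₀ - a₀) *_) (ι*recip k)) (*-identityʳ _))
  b₀<end : b₀ < a₀ + ι (suc n) * recip k
  b₀<end = subst (_< a₀ + ι (suc n) * recip k)
    (trans (cong (a₀ +_) lem) (solve 2 (λ a b → a :+ (b :- a) := b) refl a₀ b₀))
    (+-monoʳ-< a₀ (*ʳ-< (0<recip k) (proj₂ find-n)))
  x<end : upper x (a₀ + ι (suc n) * recip k)
  x<end = upper-up x b₀<end (proj₂ (upper-inhabited x))

-- Rational intervals around x and y; the product x y lies strictly between the
-- least and the greatest product of their endpoints.
record Box (x y : ℝ) : Set where
  field
    {a b c d} : ℚ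
    a<x : lower x a
    x<b : upper x b
    c<y : lower y c
    y<d : upper y d

  least greatest : ℚ
  least    = ((a * c) ⊓ (a * d)) ⊓ ((b * c) ⊓ (b * d))
  greatest = ((a * c) ⊔ (a * d)) ⊔ ((b * c) ⊔ (b * d))

open Box using (least; greatest)

segment-min : ∀ {m a s b} c → a ≤ s → s ≤ b → m ≤ a * c → m ≤ b * c → m ≤ s * c
segment-min c a≤s s≤b m≤ac m≤bc with ≤-total 0ℚ c
... | inj₁ 0≤c = ≤-trans m≤ac (*ʳ-≤ 0≤c a≤s)
... | inj₂ c≤0 = ≤-trans m≤bc (*-monoʳ-≤-nonPos c {{nonPositive c≤0}} s≤b)

segment-max : ∀ {m a s b} c → a ≤ s → s ≤ b → a * c ≤ m → b * c ≤ m → s * c ≤ m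
segment-max c a≤s s≤b ac≤m bc≤m with ≤-total 0ℚ c
... | inj₁ 0≤c = ≤-trans (*ʳ-≤ 0≤c s≤b) bc≤m
... | inj₂ c≤0 = ≤-trans (*-monoʳ-≤-nonPos c {{nonPositive c≤0}} a≤s) ac≤m

module _ {x y : ℝ} (B : Box x y) where
  open Box B using (a; b; c; d)

  least≤ac : least B ≤ a * c
  least≤ac = ≤-trans (p⊓q≤p ((a * c) ⊓ (a * d)) ((b * c) ⊓ (b * d))) (p⊓q≤p (a * c) (a * d))
  least≤ad : least B ≤ a * d
  least≤ad = ≤-trans (p⊓q≤p ((a * c) ⊓ (a * d)) ((b * c) ⊓ (b * d))) (p⊓q≤q (a * c) (a * d))
  least≤bc : least B ≤ b * c
  least≤bc = ≤-trans (p⊓q≤q ((a * c) ⊓ (a * d)) ((b * c) ⊓ (b * d))) (p⊓q≤p (b * c) (b * d))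
  least≤bd : least B ≤ b * d
  least≤bd = ≤-trans (p⊓q≤q ((a * c) ⊓ (a * d)) ((b * c) ⊓ (b * d))) (p⊓q≤q (b * c) (b * d))

  ac≤greatest : a * c ≤ greatest B
  ac≤greatest = ≤-trans (p≤p⊔q (a * c) (a * d)) (p≤p⊔q ((a * c) ⊔ (a * d)) ((b * c) ⊔ (b * d)))
  ad≤greatest : a * d ≤ greatest B
  ad≤greatest = ≤-trans (p≤q⊔p (a * c) (a * d)) (p≤p⊔q ((a * c) ⊔ (a * d)) ((b * c) ⊔ (b * d)))
  bc≤greatest : b * c ≤ greatest B
  bc≤greatest = ≤-trans (p≤p⊔q (b * c) (b * d)) (p≤q⊔p ((a * c) ⊔ (a * d)) ((b * c) ⊔ (b * d)))
  bd≤greatest : b * d ≤ greatest B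
  bd≤greatest = ≤-trans (p≤q⊔p (b * c) (b * d)) (p≤q⊔p ((a * c) ⊔ (a * d)) ((b * c) ⊔ (b * d)))

  least≤ : ∀ {s t} → a ≤ s → s ≤ b → c ≤ t → t ≤ d → least B ≤ s * t
  least≤ {s} {t} a≤s s≤b c≤t t≤d = subst (least B ≤_) (*-comm t s)
    (segment-min s c≤t t≤d
      (subst (least B ≤_) (*-comm s c) (segment-min c a≤s s≤b least≤ac least≤bc))
      (subst (least B ≤_) (*-comm s d) (segment-min d a≤s s≤b least≤ad least≤bd)))

  ≤greatest : ∀ {s t} → a ≤ s → s ≤ b → c ≤ t → t ≤ d → s * t ≤ greatest B
  ≤greatest {s} {t} a≤s s≤b c≤t t≤d = subst (_≤ greatest B) (*-comm t s)
    (segment-max s c≤t t≤d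
      (subst (_≤ greatest B) (*-comm s c) (segment-max c a≤s s≤b ac≤greatest bc≤greatest))
      (subst (_≤ greatest B) (*-comm s d) (segment-max d a≤s s≤b ad≤greatest bd≤greatest)))

<⊓ : ∀ {m p q} → m < p → m < q → m < p ⊓ q
<⊓ {m} {p} {q} m<p m<q with ≤-total p q
... | inj₁ p≤q = subst (m <_) (sym (p≤q⇒p⊓q≡p p≤q)) m<p
... | inj₂ q≤p = subst (m <_) (sym (p≥q⇒p⊓q≡q q≤p)) m<q

⊔< : ∀ {m p q} → p < m → q < m → p ⊔ q < m
⊔< {m} {p} {q} p<m q<m with ≤-total p q
... | inj₁ p≤q = subst (_< m) (sym (p≤q⇒p⊔q≡q p≤q)) q<m
... | inj₂ q≤p = subst (_< m) (sym (p≥q⇒p⊔q≡p q≤p)) p<m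

boxes-meet : ∀ {x y} (B C : Box x y) → least B ≤ greatest C
boxes-meet {x} {y} B C = ≤-trans
  (least≤ B {s} {t} (p≤p⊔q (Box.a B) (Box.a C)) (⊔-lub (x-ends B B) (x-ends C B))
    (p≤p⊔q (Box.c B) (Box.c C)) (⊔-lub (y-ends B B) (y-ends C B)))
  (≤greatest C {s} {t} (p≤q⊔p (Box.a B) (Box.a C)) (⊔-lub (x-ends B C) (x-ends C C))
    (p≤q⊔p (Box.c B) (Box.c C)) (⊔-lub (y-ends B C) (y-ends C C)))
  where
  s t : ℚ
  s = Box.a B ⊔ Box.a C
  t = Box.c B ⊔ Box.c C
  x-ends : ∀ (B C : Box x y) → Box.a B ≤ Box.b C
  x-ends B C = <⇒≤ (lower<upper x (Box.a<x B) (Box.x<b C))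
  y-ends : ∀ (B C : Box x y) → Box.c B ≤ Box.d C
  y-ends B C = <⇒≤ (lower<upper y (Box.c<y B) (Box.y<d C))

record BoundedWithin (x : ℝ) (M δ : ℚ) : Set where
  field
    {a b} : ℚ
    a<x   : lower x a
    x<b   : upper x b
    b<a+δ : b < a + δ
    -M≤a  : - M ≤ a
    a≤M   : a ≤ M
    -M≤b  : - M ≤ b
    b≤M   : b ≤ M

bounded : ∀ x → ∃[ M ] (0ℚ ≤ M × (∀ {N δ} → M ≤ N → 0ℚ < δ → δ ≤ 1ℚ → BoundedWithin x N δ))
bounded x = M , <⇒≤ (0<+0≤ 0<1 (≤-trans (0≤∣p∣ a₀) (p≤p⊔q ∣ a₀ ∣ ∣ b₀ ∣))) , refined
  where
  a₀ b₀ M : ℚ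
  a₀ = proj₁ (lower-inhabited x)
  b₀ = proj₁ (upper-inhabited x)
  M  = 1ℚ + (∣ a₀ ∣ ⊔ ∣ b₀ ∣)
  refined : ∀ {N δ} → M ≤ N → 0ℚ < δ → δ ≤ 1ℚ → BoundedWithin x N δ
  refined {N} {δ} M≤N 0<δ δ≤1 = record
    { a<x = a<x ; x<b = x<b ; b<a+δ = b<a+δ
    ; -M≤a = -N≤a ; a≤M = ≤-trans a≤b b≤N ; -M≤b = ≤-trans -N≤a a≤b ; b≤M = b≤N }
    where
    w : Within x δ
    w = approximate x 0<δ
    a b : ℚ
    a = proj₁ w
    b = proj₁ (proj₂ w)
    a<x : lower x a
    a<x = proj₁ (proj₂ (proj₂ w))
    x<b : upper x b
    x<b = proj₁ (proj₂ (proj₂ (proj₂ w)))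
    b<a+δ : b < a + δ
    b<a+δ = proj₂ (proj₂ (proj₂ (proj₂ w)))
    a≤b : a ≤ b
    a≤b = <⇒≤ (lower<upper x a<x x<b)
    b<a+1 : b < a + 1ℚ
    b<a+1 = <-≤-trans b<a+δ (+-monoʳ-≤ a δ≤1)
    b≤N : b ≤ N
    b≤N = ≤-trans (<⇒≤ b<a+1) (≤-trans (≤-reflexive (+-comm a 1ℚ))
      (≤-trans (+-monoʳ-≤ 1ℚ (≤-trans (<⇒≤ (lower<upper x a<x (proj₂ (upper-inhabited x))))
        (≤-trans (p≤∣p∣ b₀) (p≤q⊔p ∣ a₀ ∣ ∣ b₀ ∣)))) M≤N))
    a₀<a+1 : a₀ < a + 1ℚ
    a₀<a+1 = <-trans (lower<upper x (proj₂ (lower-inhabited x)) x<b) b<a+1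
    -a≤M : - a ≤ M
    -a≤M = ≤-trans
      (0≤q-p⇒p≤q (subst (0ℚ ≤_)
        (solve 2 (λ a a₀ → a :+ con 1ℚ :- a₀ := con 1ℚ :+ (:- a₀) :- (:- a)) refl a a₀)
        (<⇒≤ (0<q-p a₀<a+1))))
      (+-monoʳ-≤ 1ℚ (≤-trans (p≤∣p∣ (- a₀)) (≤-trans (≤-reflexive (∣-p∣≡∣p∣ a₀)) (p≤p⊔q ∣ a₀ ∣ ∣ b₀ ∣))))
    -N≤a : - N ≤ a
    -N≤a = subst (- N ≤_) (solve 1 (λ a → :- (:- a) := a) refl a)
      (neg-antimono-≤ (≤-trans -a≤M M≤N))

_≤±_ : ℚ → ℚ → Set
t ≤± e = - e ≤ t × t ≤ e

≤±-+ : ∀ {s t d e} → s ≤± d → t ≤± e → (s + t) ≤± (d + e)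
≤±-+ {d = d} {e} (l , u) (l' , u') =
  subst (_≤ _) (sym (neg-distrib-+ d e)) (+-mono-≤ l l') , +-mono-≤ u u'

≤±-weaken : ∀ {t d e} → d ≤ e → t ≤± d → t ≤± e
≤±-weaken d≤e (l , u) = ≤-trans (neg-antimono-≤ d≤e) l , ≤-trans u d≤e

≤±-* : ∀ {w δ c M} → 0ℚ ≤ w → w ≤ δ → 0ℚ ≤ M → c ≤± M → (w * c) ≤± (δ * M)
≤±-* {w} {δ} {c} {M} 0≤w w≤δ 0≤M (-M≤c , c≤M) =
  ≤-trans (neg-antimono-≤ (*ʳ-≤ 0≤M w≤δ))
    (≤-trans (≤-reflexive (neg-distribʳ-* w M)) (*ˡ-≤ 0≤w -M≤c)) ,
  ≤-trans (*ˡ-≤ 0≤w c≤M) (*ʳ-≤ 0≤M w≤δ)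

-- A box of width at most δ whose coordinates are bounded by M has corner products
-- within 2δM of each other, so it settles whether the product exceeds q or stays
-- below r.
module _ {x y : ℝ} {M δ q m r : ℚ} (0≤M : 0ℚ ≤ M) (0<δ : 0ℚ < δ)
         (small-q : δ * M + δ * M < m - q) (small-r : δ * M + δ * M < r - m)
         (X : BoundedWithin x M δ) (Y : BoundedWithin y M δ) where
  private
    module X = BoundedWithin X
    module Y = BoundedWithin Y
    open X using (a; b)
    open Y using () renaming (a to c; b to d)

    E : ℚ
    E = δ * M + δ * M

    box : Box x y
    box = record { a<x = X.a<x ; x<b = X.x<b ; c<y = Y.a<x ; y<d = Y.x<b }

    width : ∀ {p q} → p < q → q < p + δ → 0ℚ ≤ q - p × q - p ≤ δ
    width {p} {q} p<q q<p+δ = <⇒≤ (0<q-p p<q) , 0≤q-p⇒p≤q (subst (0ℚ ≤_)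
      (solve 3 (λ p q δ → p :+ δ :- q := δ :- (q :- p)) refl p q δ) (<⇒≤ (0<q-p q<p+δ)))

    xw : 0ℚ ≤ b - a × b - a ≤ δ
    xw = width (lower<upper x X.a<x X.x<b) X.b<a+δ
    yw : 0ℚ ≤ d - c × d - c ≤ δ
    yw = width (lower<upper y Y.a<x Y.x<b) Y.b<a+δ

    0≤δM : 0ℚ ≤ δ * M
    0≤δM = 0≤* (<⇒≤ 0<δ) 0≤M

    δM≤E : δ * M ≤ E
    δM≤E = subst (_≤ E) (+-identityʳ (δ * M)) (+-monoʳ-≤ (δ * M) 0≤δM)

    xw*c : ((b - a) * c) ≤± (δ * M)
    xw*c = ≤±-* (proj₁ xw) (proj₂ xw) 0≤M (Y.-M≤a , Y.a≤M)
    xw*d : ((b - a) * d) ≤± (δ * M)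
    xw*d = ≤±-* (proj₁ xw) (proj₂ xw) 0≤M (Y.-M≤b , Y.b≤M)
    yw*a : ((d - c) * a) ≤± (δ * M)
    yw*a = ≤±-* (proj₁ yw) (proj₂ yw) 0≤M (X.-M≤a , X.a≤M)

    Near : ℚ → Set
    Near z = (z - a * c) ≤± E

    ac-near : Near (a * c)
    ac-near = subst (_≤± E) (sym (+-inverseʳ (a * c)))
      (≤±-weaken δM≤E (neg-antimono-≤ 0≤δM , 0≤δM))
    bc-near : Near (b * c)
    bc-near = subst (_≤± E)
      (solve 3 (λ a b c → (b :- a) :* c := b :* c :- a :* c) refl a b c)
      (≤±-weaken δM≤E xw*c)
    ad-near : Near (a * d)
    ad-near = subst (_≤± E)
      (solve 3 (λ a c d → (d :- c) :* a := a :* d :- a :* c) refl a c d)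
      (≤±-weaken δM≤E yw*a)
    bd-near : Near (b * d)
    bd-near = subst (_≤± E)
      (solve 4 (λ a b c d → (b :- a) :* d :+ (d :- c) :* a := b :* d :- a :* c) refl a b c d)
      (≤±-+ xw*d yw*a)

    above-q : m ≤ a * c → ∀ z → Near z → q < z
    above-q m≤ac z (-E≤ , _) = 0<q-p⇒p<q (subst (0ℚ <_)
      (solve 5 (λ q m E z w → (m :- q :- E) :+ ((z :- w :- (:- E)) :+ (w :- m)) := z :- q)
        refl q m E z (a * c))
      (0<+0≤ (0<q-p small-q) (0≤+ (0≤q-p -E≤) (0≤q-p m≤ac))))

    below-r : a * c ≤ m → ∀ z → Near z → z < r
    below-r ac≤m z (_ , ≤E) = 0<q-p⇒p<q (subst (0ℚ <_)
      (solve 5 (λ r m E z w → (r :- m :- E) :+ ((E :- (z :- w)) :+ (m :- w)) := r :- z)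
        refl r m E z (a * c))
      (0<+0≤ (0<q-p small-r) (0≤+ (0≤q-p ≤E) (0≤q-p ac≤m))))

  small-box : (∃[ B ] q < least {x} {y} B) ⊎ (∃[ B ] greatest {x} {y} B < r)
  small-box with ≤-total m (a * c)
  ... | inj₁ m≤ac = inj₁ (box , <⊓ (<⊓ (above-q m≤ac (a * c) ac-near) (above-q m≤ac (a * d) ad-near))
                                   (<⊓ (above-q m≤ac (b * c) bc-near) (above-q m≤ac (b * d) bd-near)))
  ... | inj₂ ac≤m = inj₂ (box , ⊔< (⊔< (below-r ac≤m (a * c) ac-near) (below-r ac≤m (a * d) ad-near))
                                   (⊔< (below-r ac≤m (b * c) bc-near) (below-r ac≤m (b * d) bd-near)))

infixl 7 _*ℝ_

_*ℝ_ : ℝ → ℝ → ℝ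
x *ℝ y = record
  { lower           = λ q → ∃[ B ] q < least {x} {y} B
  ; upper           = λ q → ∃[ B ] greatest {x} {y} B < q
  ; lower-inhabited = let q , q< = below (least box₀) in q , box₀ , q<
  ; upper-inhabited = let q , <q = above (greatest box₀) in q , box₀ , <q
  ; lower-down      = λ p<q (B , q<) → B , <-trans p<q q<
  ; upper-up        = λ p<q (B , <p) → B , <-trans <p p<q
  ; lower-open      = λ (B , p<) → let q , p<q , q< = <-dense p< in q , p<q , B , q<
  ; upper-open      = λ (B , <q) → let p , <p , p<q = <-dense <q in p , p<q , B , <p
  ; disjoint        = λ (B , q<) (C , <q) → <-irrefl refl (<-trans (<-≤-trans q< (boxes-meet B C)) <q)
  ; located         = locate
  }
  where
  box₀ : Box x y
  box₀ = record
    { a<x = proj₂ (lower-inhabited x) ; x<b = proj₂ (upper-inhabited x)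
    ; c<y = proj₂ (lower-inhabited y) ; y<d = proj₂ (upper-inhabited y) }

  locate : ∀ {q r} → q < r → (∃[ B ] q < least {x} {y} B) ⊎ (∃[ B ] greatest {x} {y} B < r)
  locate {q} {r} q<r =
    let m , q<m , m<r  = <-dense q<r
        Mx , 0≤Mx , bx = bounded x
        My , _    , by = bounded y
        k , k-small    = small ((Mx ⊔ My) + (Mx ⊔ My)) (<⊓ (0<q-p q<m) (0<q-p m<r))
        E<e            = subst (_< (m - q) ⊓ (r - m))
          (solve 2 (λ M δ → (M :+ M) :* δ := δ :* M :+ δ :* M) refl (Mx ⊔ My) (recip k)) k-small
        δ≤1            = recip-anti {0} {k} (ι-mono {1} {suc k} (ℕ.s≤s ℕ.z≤n))
    in small-box {x} {y} {Mx ⊔ My} {recip k} {q} {m} {r} (≤-trans 0≤Mx (p≤p⊔q Mx My)) (0<recip k)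
         (<-≤-trans E<e (p⊓q≤p (m - q) (r - m))) (<-≤-trans E<e (p⊓q≤q (m - q) (r - m)))
         (bx (p≤p⊔q Mx My) (0<recip k) δ≤1) (by (p≤q⊔p Mx My) (0<recip k) δ≤1)

-- The square root of a nonnegative real; negative reals are sent to 0.
√_ : ℝ → ℝ
√ x = record
  { lower           = λ q → ∃[ s ] (q < s × (s ≤ 0ℚ ⊎ lower x (s * s)))
  ; upper           = λ q → ∃[ s ] (s < q × 0ℚ < s × upper x (s * s))
  ; lower-inhabited = - 1ℚ , 0ℚ , *<* ℤ.-<+ , inj₁ ≤-refl
  ; upper-inhabited = let q , u<q = above u in q , u , u<q , 0<u ,
                        upper-up x b₀<u² (proj₂ (upper-inhabited x))
  ; lower-down      = λ p<q (s , q<s , hs) → s , <-trans p<q q<s , hs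
  ; upper-up        = λ p<q (s , s<p , hs) → s , <-trans s<p p<q , hs
  ; lower-open      = λ (s , p<s , hs) → let q , p<q , q<s = <-dense p<s in q , p<q , s , q<s , hs
  ; upper-open      = λ (s , s<q , hs) → let p , s<p , p<q = <-dense s<q in p , p<q , s , s<p , hs
  ; disjoint        = apart
  ; located         = locate
  }
  where
  b₀ u : ℚ
  b₀ = proj₁ (upper-inhabited x)
  u = 1ℚ + ∣ b₀ ∣
  0<u : 0ℚ < u
  0<u = 0<+0≤ 0<1 (0≤∣p∣ b₀)
  b₀<u² : b₀ < u * u
  b₀<u² = ≤-<-trans (p≤∣p∣ b₀) (0<q-p⇒p<q (subst (0ℚ <_)
    (solve 1 (λ v → (con 1ℚ :+ v) :+ v :* v := (con 1ℚ :+ v) :* (con 1ℚ :+ v) :- v) refl ∣ b₀ ∣)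
    (0<+0≤ 0<u (0≤p² ∣ b₀ ∣))))

  square-mono : ∀ {s t} → 0ℚ < s → s < t → s * s < t * t
  square-mono 0<s s<t = <-trans (*ʳ-< 0<s s<t) (*ˡ-< (<-trans 0<s s<t) s<t)

  apart : ∀ {q} → ∃[ s ] (q < s × (s ≤ 0ℚ ⊎ lower x (s * s))) →
          ∃[ s ] (s < q × 0ℚ < s × upper x (s * s)) → ⊥
  apart (s , q<s , inj₁ s≤0) (t , t<q , 0<t , _) =
    <-irrefl refl (<-≤-trans (<-trans 0<t (<-trans t<q q<s)) s≤0)
  apart (s , q<s , inj₂ s²<x) (t , t<q , 0<t , x<t²) =
    <-asym (lower<upper x s²<x x<t²) (square-mono 0<t (<-trans t<q q<s))

  locate : ∀ {q r} → q < r → ∃[ s ] (q < s × (s ≤ 0ℚ ⊎ lower x (s * s))) ⊎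
                             ∃[ s ] (s < r × 0ℚ < s × upper x (s * s))
  locate {q} {r} q<r with <-dense q<r
  ... | t , q<t , t<r with <-dense q<t
  ...   | s , q<s , s<t with s ≤? 0ℚ
  ...     | yes s≤0 = inj₁ (s , q<s , inj₁ s≤0)
  ...     | no  s≰0 with located x (square-mono (≰⇒> s≰0) s<t)
  ...       | inj₁ s²<x = inj₁ (s , q<s , inj₂ s²<x)
  ...       | inj₂ x<t² = inj₂ (t , t<r , <-trans (≰⇒> s≰0) s<t , x<t²)

module _ {x : ℝ} {q r i a b : ℚ} (0<q : 0ℚ < q) (q<r : q < r) (ir≡1 : i * r ≡ 1ℚ)
         (a<x : lower x a) (x<b : upper x b) where
  private
    compare : ∀ k → 0ℚ < lowerBase a k → 0ℚ < upperBase b k →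
              q * i < lowerBase a k ^ suc k * upperBase b k ^ suc k →
              ∃[ p ] (lower x p × q <exp p) ⊎ ∃[ p ] (upper x p × p exp< r)
    compare k 0<A 0<B qi<AB = decide (A ≤? q)
      where
      A B : ℚ
      A = lowerBase a k ^ suc k
      B = upperBase b k ^ suc k
      decide : Dec (A ≤ q) → ∃[ p ] (lower x p × q <exp p) ⊎ ∃[ p ] (upper x p × p exp< r)
      decide (no  A≰q) = inj₁ (a , a<x , k , 0<A , ≰⇒> A≰q)
      decide (yes A≤q) = inj₂ (b , x<b , k , 0<B , 1<rB)
        where
        iq<Bq : i * q < B * q
        iq<Bq = subst₂ _<_ (*-comm q i) (*-comm q B)
          (<-≤-trans qi<AB (*ʳ-≤ (<⇒≤ (^-pos (suc k) 0<B)) A≤q))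
        1<rB : 1ℚ < r * B
        1<rB = subst₂ _<_ ir≡1 (*-comm B r)
          (*ʳ-< (<-trans 0<q q<r) (*-cancelʳ-< {i} {B} 0<q iq<Bq))

  exp-locate : b < a + (1ℚ - q * i) →
               ∃[ p ] (lower x p × q <exp p) ⊎ ∃[ p ] (upper x p × p exp< r)
  exp-locate b<a+ =
    let k , 0<A , 0<B , qi<AB = exp-approx a b close in compare k 0<A 0<B qi<AB
    where
    close : q * i < 1ℚ + a - b
    close = 0<q-p⇒p<q (subst (0ℚ <_)
      (solve 3 (λ a b θ → a :+ (con 1ℚ :- θ) :- b := con 1ℚ :+ a :- b :- θ) refl a b (q * i))
      (0<q-p b<a+))

exp : ℝ → ℝ
exp x = record
  { lower           = λ q → ∃[ p ] (lower x p × q <exp p)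
  ; upper           = λ q → ∃[ p ] (upper x p × p exp< q)
  ; lower-inhabited = let p , p<x = lower-inhabited x
                          k , 0<A = lower-base p in 0ℚ , p , p<x , k , 0<A , ^-pos (suc k) 0<A
  ; upper-inhabited = upper-bound
  ; lower-down      = λ q<r (p , p<x , k , 0<A , r<A) → p , p<x , k , 0<A , <-trans q<r r<A
  ; upper-up        = λ q<r (p , x<p , k , 0<B , 1<qB) →
                        p , x<p , k , 0<B , <-trans 1<qB (*ʳ-< (^-pos (suc k) 0<B) q<r)
  ; lower-open      = λ (p , p<x , k , 0<A , q<A) →
                        let r , q<r , r<A = <-dense q<A in r , q<r , p , p<x , k , 0<A , r<A
  ; upper-open      = shrink
  ; disjoint        = λ (p , p<x , q<eᵖ) (p' , x<p' , eᵖ'<q) →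
                        <-irrefl refl (exp-sep (<⇒≤ (lower<upper x p<x x<p')) q<eᵖ eᵖ'<q)
  ; located         = locate
  }
  where
  lower-base : ∀ p → ∃[ k ] (0ℚ < lowerBase p k)
  lower-base p = let k , -p<k = archimedean (- p) in k , scale-pos k -p<k

  upper-base : ∀ p → ∃[ k ] (0ℚ < upperBase p k)
  upper-base p = let k , p<k = archimedean (- (- p)) in
    k , subst (λ z → 0ℚ < 1ℚ + z) (sym (neg-distribˡ-* p (recip k))) (scale-pos k p<k)

  upper-bound : ∃[ q ] ∃[ p ] (upper x p × p exp< q)
  upper-bound =
    let p , x<p         = upper-inhabited x
        k , 0<B         = upper-base p
        i , 0<i , i*B≡1 = inverse (^-pos (suc k) 0<B)
        q , i<q         = above i
    in q , p , x<p , k , 0<B , subst (_< q * upperBase p k ^ suc k) i*B≡1 (*ʳ-< (^-pos (suc k) 0<B) i<q)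

  shrink : ∀ {q} → ∃[ p ] (upper x p × p exp< q) → ∃[ r ] (r < q × ∃[ p ] (upper x p × p exp< r))
  shrink {q} (p , x<p , k , 0<B , 1<qB) =
    let i , 0<i , i*B≡1 = inverse (^-pos (suc k) 0<B)
        i<q = *-cancelʳ-< {i} {q} (^-pos (suc k) 0<B) (subst (_< q * upperBase p k ^ suc k) (sym i*B≡1) 1<qB)
        r , i<r , r<q   = <-dense i<q
    in r , r<q , p , x<p , k , 0<B , subst (_< r * upperBase p k ^ suc k) i*B≡1 (*ʳ-< (^-pos (suc k) 0<B) i<r)

  locate : ∀ {q r} → q < r → ∃[ p ] (lower x p × q <exp p) ⊎ ∃[ p ] (upper x p × p exp< r)
  locate {q} {r} q<r with q ≤? 0ℚ
  ... | yes q≤0 =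
    let p , p<x = lower-inhabited x
        k , 0<A = lower-base p
    in inj₁ (p , p<x , k , 0<A , ≤-<-trans q≤0 (^-pos (suc k) 0<A))
  ... | no  q≰0 =
    let 0<q             = ≰⇒> q≰0
        i , 0<i , ir≡1  = inverse (<-trans 0<q q<r)
        qi<1            = subst (q * i <_) (trans (*-comm r i) ir≡1) (*ʳ-< 0<i q<r)
        a , b , a<x , x<b , b<a+ = approximate x (0<q-p qi<1)
    in exp-locate {x} {q} {r} {i} {a} {b} 0<q q<r ir≡1 a<x x<b b<a+

exp-strict : ∀ {q r} → q < r → ∃[ s ] ∃[ t ] (s < t × q exp< s × t <exp r)
exp-strict {q} {r} q<r =
  let k , 0<A , 0<B , 1<AB = exp-approx r q 1<1+r-q in separate k 0<A 0<B 1<AB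
  where
  1<1+r-q : 1ℚ < 1ℚ + r - q
  1<1+r-q = 0<q-p⇒p<q (subst (0ℚ <_)
    (solve 2 (λ q r → r :- q := con 1ℚ :+ r :- q :- con 1ℚ) refl q r) (0<q-p q<r))
  separate : ∀ k → 0ℚ < lowerBase r k → 0ℚ < upperBase q k →
             1ℚ < lowerBase r k ^ suc k * upperBase q k ^ suc k →
             ∃[ s ] ∃[ t ] (s < t × q exp< s × t <exp r)
  separate k 0<A 0<B 1<AB =
    let B               = upperBase q k ^ suc k
        0<Bᵏ            = ^-pos (suc k) 0<B
        i , _ , iB≡1    = inverse 0<Bᵏ
        i<A             = *-cancelʳ-< {i} {lowerBase r k ^ suc k} 0<Bᵏ (subst (_< lowerBase r k ^ suc k * B) (sym iB≡1) 1<AB)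
        t , i<t , t<A   = <-dense i<A
        s , i<s , s<t   = <-dense i<t
    in s , t , s<t , (k , 0<B , subst (_< s * B) iB≡1 (*ʳ-< 0<Bᵏ i<s)) , (k , 0<A , t<A)

-- ln is the inverse of exp: q < ln x iff exp q < x.
ln : ℝ⁺ → ℝ
ln (x , s₀ , 0<s₀ , s₀<x) = record
  { lower           = λ q → exp (fromℚ q) <ℝ x
  ; upper           = λ q → x <ℝ exp (fromℚ q)
  ; lower-inhabited = lower-bound
  ; upper-inhabited = upper-bound
  ; lower-down      = λ p<q (s , (t , q<t , eᵗ<s) , s<x) → s , (t , <-trans p<q q<t , eᵗ<s) , s<x
  ; upper-up        = λ p<q (s , x<s , t , t<p , s<eᵗ) → s , x<s , t , <-trans t<p p<q , s<eᵗ
  ; lower-open      = λ (s , (t , p<t , eᵗ<s) , s<x) →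
                        let q , p<q , q<t = <-dense p<t in q , p<q , s , (t , q<t , eᵗ<s) , s<x
  ; upper-open      = λ (s , x<s , t , t<q , s<eᵗ) →
                        let p , t<p , p<q = <-dense t<q in p , p<q , s , x<s , t , t<p , s<eᵗ
  ; disjoint        = λ (s , (t , q<t , eᵗ<s) , s<x) (s' , x<s' , t' , t'<q , s'<eᵗ') →
                        <-asym (lower<upper x s<x x<s')
                          (exp-sep (<⇒≤ (<-trans t'<q q<t)) s'<eᵗ' eᵗ<s)
  ; located         = locate
  }
  where
  lower-bound : ∃[ q ] (exp (fromℚ q) <ℝ x)
  lower-bound = q , s₀ , (- i , q<-i , 0 , 0<B , 1<s₀B) , s₀<x
    where
    inv : ∃[ i ] (0ℚ < i × i * s₀ ≡ 1ℚ)
    inv = inverse 0<s₀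
    i : ℚ
    i = proj₁ inv
    q : ℚ
    q = proj₁ (below (- i))
    q<-i : q < - i
    q<-i = proj₂ (below (- i))
    base : upperBase (- i) 0 ≡ 1ℚ + i
    base = solve 1 (λ i → con 1ℚ :- (:- i) :* con 1ℚ := con 1ℚ :+ i) refl i
    0<B : 0ℚ < upperBase (- i) 0
    0<B = subst (0ℚ <_) (sym base) (0<+ 0<1 (proj₁ (proj₂ inv)))
    1<s₀B : 1ℚ < s₀ * upperBase (- i) 0 ^ 1
    1<s₀B = subst (λ z → 1ℚ < s₀ * z) (trans (sym base) (sym (*-identityʳ (upperBase (- i) 0))))
      (0<q-p⇒p<q (subst (0ℚ <_)
        (trans (solve 2 (λ s i → s := s :* (con 1ℚ :+ i) :- i :* s) refl s₀ i)
          (cong (λ z → s₀ * (1ℚ + i) - z) (proj₂ (proj₂ inv))))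
        0<s₀))

  upper-bound : ∃[ q ] (x <ℝ exp (fromℚ q))
  upper-bound = q , s , proj₂ (upper-inhabited x) , ∣ s ∣ , proj₂ (above ∣ s ∣) , 0 , 0<A , s<A
    where
    s q : ℚ
    s = proj₁ (upper-inhabited x)
    q = proj₁ (above ∣ s ∣)
    base : lowerBase ∣ s ∣ 0 ≡ 1ℚ + ∣ s ∣
    base = cong (1ℚ +_) (*-identityʳ ∣ s ∣)
    0<A : 0ℚ < lowerBase ∣ s ∣ 0
    0<A = subst (0ℚ <_) (sym base) (0<+0≤ 0<1 (0≤∣p∣ s))
    s<A : s < lowerBase ∣ s ∣ 0 ^ 1
    s<A = subst (s <_) (trans (sym base) (sym (*-identityʳ (lowerBase ∣ s ∣ 0))))
      (≤-<-trans (p≤∣p∣ s) (subst (_< 1ℚ + ∣ s ∣) (+-identityˡ ∣ s ∣) (+-monoˡ-< ∣ s ∣ 0<1)))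

  locate : ∀ {q r} → q < r → exp (fromℚ q) <ℝ x ⊎ x <ℝ exp (fromℚ r)
  locate q<r =
    let q' , q<q' , q'<r          = <-dense q<r
        r' , q'<r' , r'<r         = <-dense q'<r
        s , t , s<t , e<s , t<e   = exp-strict q'<r'
    in finish q<q' r'<r e<s t<e (located x s<t)
    where
    finish : ∀ {q q' r' r s t} → q < q' → r' < r → q' exp< s → t <exp r' →
             lower x s ⊎ upper x t → exp (fromℚ q) <ℝ x ⊎ x <ℝ exp (fromℚ r)
    finish q<q' r'<r e<s t<e (inj₁ s<x) = inj₁ (_ , (_ , q<q' , e<s) , s<x)
    finish q<q' r'<r e<s t<e (inj₂ x<t) = inj₂ (_ , x<t , _ , r'<r , t<e)

infixr 8 _^ℝ_

_^ℝ_ : ℝ⁺ → ℝ → ℝ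
c ^ℝ y = exp (y *ℝ ln c)

{-# OPTIONS --safe #-}
module Submission where

-- Let T be a set of k coordinates and Y a set of words of length k over q letters, and
-- take T ∪ Y as vertices. The edges are T, Y and the sets E(t,a) = {t} ∪ {y ∈ Y : yₜ = a}.
-- The line through two coordinates is T, the one through t and y is E(t,yₜ), and the one
-- through two words y, y′ is Y ∪ {t : yₜ = y′ₜ}. So there are at most 1 + kq + 2ᵏ lines,
-- and none of them is universal as soon as k ≥ 2. Taking q = 2ᵏ accommodates
-- 2^(k²) words with at most 2^(2k+1) lines; k is chosen so that
-- 2^((k-1)²) < n ≤ 2^(k²), which makes 2^(2k+1) at most a constant to the power √(ln n).

open import Defs
open import Algebra.Bundles using (CommutativeRing)
import Data.Bool.Properties as Bool
open import Data.Fin.Base using (Fin; zero; suc; _↑ˡ_; _↑ʳ_; splitAt; inject≤; combine; finToFun; funToFin)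
import Data.Fin.Properties as Fin
open import Data.Fin.Subset using (Subset; inside; outside; _∈_; _∉_; ⊤; ⊥; ⁅_⁆; ∣_∣)
import Data.Fin.Subset.Properties as Subset
open import Data.Integer.Base using (+_)
open import Data.List.Base as List using (List; []; _∷_; [_]; length; map; filter; deduplicate; allFin; cartesianProduct)
open import Data.List.Extrema.Nat using (argmin; argmin-all; f[argmin]≤f[xs])
import Data.List.Properties as List
open import Data.List.Membership.Propositional using (lose; find) renaming (_∈_ to _∈ˡ_)
open import Data.List.Membership.Propositional.Properties
  using (∈-∃++; ∈-++⁺ˡ; ∈-++⁺ʳ; ∈-++⁻; ∈-map⁺; ∈-map⁻; ∈-filter⁺; ∈-filter⁻; ∈-deduplicate⁻;
         ∈-cartesianProduct⁺; ∈-allFin)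
open import Data.List.Relation.Unary.All as All using (All; []; _∷_)
open import Data.List.Relation.Unary.All.Properties using (all-filter)
open import Data.List.Relation.Unary.Any using (Any; here; there)
open import Data.List.Relation.Unary.Unique.Propositional using (Unique; []; _∷_)
open import Data.List.Relation.Unary.Unique.DecPropositional.Properties using (deduplicate-!)
open import Data.Nat.Base using (ℕ; zero; suc; NonZero; _∸_; _+_; _*_; _^_; _≤_; _<_; s≤s; z≤n; s≤s⁻¹)
import Data.Nat.Properties as ℕ
open import Data.Product.Base using (Σ-syntax; ∃-syntax; _×_; _,_; proj₁; proj₂; uncurry)
open import Data.Rational.Base as ℚ using (ℚ; 0ℚ; 1ℚ; ½)
import Data.Rational.Properties as ℚ
import Data.Rational.Solver as ℚ
open import Algebra.Properties.CommutativeSemiring.Exp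
  (CommutativeRing.commutativeSemiring ℚ.+-*-commutativeRing)
  using () renaming (_^_ to _^ℚ_)
open import Data.Sum.Base using (_⊎_; inj₁; inj₂)
open import Data.Vec.Base using ([]; _∷_; _++_; tabulate)
import Data.Vec.Properties as Vec
open import Function.Base using (_∘_)
import Level
open import Relation.Binary.PropositionalEquality
  using (_≡_; _≢_; refl; sym; trans; cong; cong₂; subst; subst₂; module ≡-Reasoning)
open import Relation.Nullary using (Dec; yes; no; does; ¬?; _→-dec_; contradiction)
open import Relation.Nullary.Decidable using (dec-true)
open import Relation.Unary using (Pred; Decidable)
open ℝ

-- Counting in lists and enumerating subsets.

length-mono-⊆ : ∀ {A : Set} {xs ys : List A} → Unique xs → (∀ {x} → x ∈ˡ xs → x ∈ˡ ys) →
                length xs ≤ length ys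
length-mono-⊆ [] _ = z≤n
length-mono-⊆ {xs = x ∷ xs} (x∉xs ∷ xs!) xs⊆ys with ∈-∃++ (xs⊆ys (here refl))
-- One occurrence of `x` is removed from `ys`. As `x` does not recur in `xs`, the tail still lies in
-- what remains, so induction applies.
... | as , bs , refl = ℕ.≤-trans (s≤s (length-mono-⊆ xs! xs⊆as++bs))
                                 (ℕ.≤-reflexive (sym (List.length-++-sucʳ as x bs)))
  where
  xs⊆as++bs : ∀ {z} → z ∈ˡ xs → z ∈ˡ as List.++ bs
  xs⊆as++bs z∈xs with ∈-++⁻ as (xs⊆ys (there z∈xs))
  ... | inj₁ z∈as         = ∈-++⁺ˡ z∈as
  ... | inj₂ (here refl)  = contradiction refl (All.lookup x∉xs z∈xs)
  ... | inj₂ (there z∈bs) = ∈-++⁺ʳ as z∈bs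

-- Applied to `allSubsets n`, this makes the search space of hypergraphs finite: each set of edges
-- occurs once its members are put in the order of `allSubsets n`.
sublists : ∀ {A : Set} → List A → List (List A)
sublists []       = [ [] ]
sublists (x ∷ xs) = map (x ∷_) (sublists xs) List.++ sublists xs

filter-∈-sublists : ∀ {A : Set} {P : Pred A Level.zero} (P? : Decidable P) xs → filter P? xs ∈ˡ sublists xs
filter-∈-sublists P? []       = here refl
filter-∈-sublists P? (x ∷ xs) with P? x
... | yes _ = ∈-++⁺ˡ (∈-map⁺ (x ∷_) (filter-∈-sublists P? xs))
... | no  _ = ∈-++⁺ʳ (map (x ∷_) (sublists xs)) (filter-∈-sublists P? xs)

allSubsets : ∀ n → List (Subset n)
allSubsets zero    = [ [] ]
allSubsets (suc n) = map (inside ∷_) (allSubsets n) List.++ map (outside ∷_) (allSubsets n)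

∈-allSubsets : ∀ {n} (S : Subset n) → S ∈ˡ allSubsets n
∈-allSubsets []            = here refl
∈-allSubsets (inside  ∷ S) = ∈-++⁺ˡ (∈-map⁺ (inside ∷_) (∈-allSubsets S))
∈-allSubsets (outside ∷ S) = ∈-++⁺ʳ (map (inside ∷_) (allSubsets _)) (∈-map⁺ (outside ∷_) (∈-allSubsets S))

length-allSubsets : ∀ n → length (allSubsets n) ≡ 2 ^ n
length-allSubsets zero    = refl
length-allSubsets (suc n) = begin
  length (map (inside ∷_) Ss List.++ map (outside ∷_) Ss)         ≡⟨ List.length-++ (map (inside ∷_) Ss) ⟩
  length (map (inside ∷_) Ss) + length (map (outside ∷_) Ss)      ≡⟨ cong₂ _+_ (List.length-map _ Ss) (List.length-map _ Ss) ⟩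
  length Ss + length Ss                                           ≡⟨ cong₂ _+_ (length-allSubsets n) (trans (length-allSubsets n) (sym (ℕ.+-identityʳ _))) ⟩
  2 ^ suc n                                                       ∎
  where
  open ≡-Reasoning
  Ss = allSubsets n

length-cartesianProduct : ∀ {A B : Set} (xs : List A) (ys : List B) →
                          length (cartesianProduct xs ys) ≡ length xs * length ys
length-cartesianProduct []       ys = refl
length-cartesianProduct (x ∷ xs) ys = trans (List.length-++ (map (x ,_) ys))
  (cong₂ _+_ (List.length-map _ ys) (length-cartesianProduct xs ys))

-- Membership in tabulated and concatenated subsets.

module _ {n} {P : Pred (Fin n) Level.zero} (P? : Decidable P) where

  ∈-tabulate⁺ : ∀ {i} → P i → i ∈ tabulate (does ∘ P?)
  ∈-tabulate⁺ {i} Pi = Vec.lookup⇒[]= i _ (trans (Vec.lookup∘tabulate (does ∘ P?) i) (dec-true (P? i) Pi))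

  ∈-tabulate⁻ : ∀ {i} → i ∈ tabulate (does ∘ P?) → P i
  ∈-tabulate⁻ {i} i∈ with P? i | trans (sym (Vec.lookup∘tabulate (does ∘ P?) i)) (Vec.[]=⇒lookup i∈)
  ... | yes Pi | _ = Pi
  ... | no  _  | ()

module _ {m n} (A : Subset m) (B : Subset n) where

  ↑ˡ∈++⁺ : ∀ {i} → i ∈ A → (i ↑ˡ n) ∈ (A ++ B)
  ↑ˡ∈++⁺ {i} i∈A = Vec.lookup⇒[]= _ _ (trans (Vec.lookup-++ˡ A B i) (Vec.[]=⇒lookup i∈A))

  ↑ˡ∈++⁻ : ∀ {i} → (i ↑ˡ n) ∈ (A ++ B) → i ∈ A
  ↑ˡ∈++⁻ {i} i∈ = Vec.lookup⇒[]= _ _ (trans (sym (Vec.lookup-++ˡ A B i)) (Vec.[]=⇒lookup i∈))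

  ↑ʳ∈++⁺ : ∀ {j} → j ∈ B → (m ↑ʳ j) ∈ (A ++ B)
  ↑ʳ∈++⁺ {j} j∈B = Vec.lookup⇒[]= _ _ (trans (Vec.lookup-++ʳ A B j) (Vec.[]=⇒lookup j∈B))

  ↑ʳ∈++⁻ : ∀ {j} → (m ↑ʳ j) ∈ (A ++ B) → j ∈ B
  ↑ʳ∈++⁻ {j} j∈ = Vec.lookup⇒[]= _ _ (trans (sym (Vec.lookup-++ʳ A B j)) (Vec.[]=⇒lookup j∈))

-- A view of `splitAt`: matching on it replaces the vertex itself by `i ↑ˡ n` or `m ↑ʳ j`, which the
-- membership lemmas for `A ++ B` require.
data Side (m n : ℕ) : Fin (m + n) → Set where
  left  : ∀ i → Side m n (i ↑ˡ n)
  right : ∀ j → Side m n (m ↑ʳ j)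

side : ∀ m {n} (i : Fin (m + n)) → Side m n i
side m {n} i with splitAt m i in eq
... | inj₁ j = subst (Side m n) (Fin.splitAt⁻¹-↑ˡ eq) (left j)
... | inj₂ j = subst (Side m n) (Fin.splitAt⁻¹-↑ʳ {m} eq) (right j)

∉⇒∣∣≤n∸1 : ∀ {n} {S : Subset n} {i} → i ∉ S → ∣ S ∣ ≤ n ∸ 1
∉⇒∣∣≤n∸1 {suc n} {S} {i} i∉S = s≤s⁻¹ (ℕ.≤-trans
  (Subset.p⊂q⇒∣p∣<∣q∣ ((λ _ → Subset.∈⊤) , i , Subset.∈⊤ , i∉S))
  (ℕ.≤-reflexive (Subset.∣⊤∣≡n (suc n))))

-- Lines of an arbitrary hypergraph.

module _ {n} (H : Hypergraph n) where

  Collinear : Fin n → Fin n → Fin n → Set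
  Collinear u v p = Any (λ T → u ∈ T × v ∈ T × p ∈ T) H

  -- The tool for computing lines. The ends of a line belong to it by definition, so apart from them
  -- the inclusion in `S` only concerns points sharing an edge with both ends.
  line≡ : ∀ {u v S} → u ∈ S → v ∈ S → (∀ {p} → Collinear u v p → p ∈ S) →
          (∀ {p} → p ∈ S → OnLine H u v p) → line H u v ≡ S
  line≡ {u} {v} {S} u∈S v∈S coll⇒∈ ∈⇒onLine = Subset.⊆-antisym
    (onLine⇒∈ ∘ ∈-tabulate⁻ (onLine? H u v)) (∈-tabulate⁺ (onLine? H u v) ∘ ∈⇒onLine)
    where
    onLine⇒∈ : ∀ {p} → OnLine H u v p → p ∈ S
    onLine⇒∈ (inj₁ (inj₁ refl)) = u∈S
    onLine⇒∈ (inj₁ (inj₂ refl)) = v∈S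
    onLine⇒∈ (inj₂ coll)        = coll⇒∈ coll

  line-comm : ∀ u v → line H u v ≡ line H v u
  line-comm u v = line≡ (∈-tabulate⁺ (onLine? H v u) (inj₁ (inj₂ refl)))
    (∈-tabulate⁺ (onLine? H v u) (inj₁ (inj₁ refl)))
    (∈-tabulate⁺ (onLine? H v u) ∘ inj₂ ∘ swap)
    (swap′ ∘ ∈-tabulate⁻ (onLine? H v u))
    where
    swap : ∀ {u v p} → Collinear u v p → Collinear v u p
    swap coll = let T , T∈H , u∈T , v∈T , p∈T = find coll in lose T∈H (v∈T , u∈T , p∈T)
    swap′ : ∀ {p} → OnLine H v u p → OnLine H u v p
    swap′ (inj₁ (inj₁ p≡v)) = inj₁ (inj₂ p≡v)
    swap′ (inj₁ (inj₂ p≡u)) = inj₁ (inj₁ p≡u)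
    swap′ (inj₂ coll)       = inj₂ (swap coll)

  linesHaveAtMost? : ∀ k → Dec (LinesHaveAtMost H k)
  linesHaveAtMost? k = Fin.all? λ u → Fin.all? λ v → ¬? (u Fin.≟ v) →-dec (∣ line H u v ∣ ℕ.≤? k)

  -- Deduplication leaves the lines without repetitions, so `length-mono-⊆` applies; each of them
  -- comes from a pair that survived the filter, hence from distinct vertices.
  numberOfLines≤ : ∀ {Ss} → (∀ u v → u ≢ v → line H u v ∈ˡ Ss) → numberOfLines H ≤ length Ss
  numberOfLines≤ {Ss} line∈ = length-mono-⊆ (deduplicate-! _ _) λ S∈ →
    let (u , v) , uv∈ , S≡ = ∈-map⁻ (uncurry (line H)) (∈-deduplicate⁻ _ _ S∈)
    in subst (_∈ˡ Ss) (sym S≡) (line∈ u v (proj₂ (∈-filter⁻ _ {xs = cartesianProduct (allFin n) (allFin n)} uv∈)))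

-- Invariance under the choice of edge list, and existence of the minimum.

module _ {n} {H H′ : Hypergraph n} (H⊆H′ : ∀ {T} → T ∈ˡ H → T ∈ˡ H′) (H′⊆H : ∀ {T} → T ∈ˡ H′ → T ∈ˡ H) where

  line-resp : ∀ u v → line H u v ≡ line H′ u v
  line-resp u v = line≡ H (∈-tabulate⁺ (onLine? H′ u v) (inj₁ (inj₁ refl)))
    (∈-tabulate⁺ (onLine? H′ u v) (inj₁ (inj₂ refl)))
    (∈-tabulate⁺ (onLine? H′ u v) ∘ inj₂ ∘ transport H⊆H′)
    (back ∘ ∈-tabulate⁻ (onLine? H′ u v))
    where
    transport : ∀ {H H′ : Hypergraph n} {p} → (∀ {T} → T ∈ˡ H → T ∈ˡ H′) → Collinear H u v p → Collinear H′ u v p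
    transport H⊆H′ coll = let T , T∈H , in∈ = find coll in lose (H⊆H′ T∈H) in∈
    back : ∀ {p} → OnLine H′ u v p → OnLine H u v p
    back (inj₁ eq)   = inj₁ eq
    back (inj₂ coll) = inj₂ (transport H′⊆H coll)

  numberOfLines-resp : numberOfLines H ≡ numberOfLines H′
  numberOfLines-resp = cong (length ∘ deduplicate (Vec.≡-dec Bool._≟_))
    (List.map-cong (λ (u , v) → line-resp u v)
      (filter (λ (u , v) → ¬? (u Fin.≟ v)) (cartesianProduct (allFin n) (allFin n))))

  linesHaveAtMost-resp : ∀ {k} → LinesHaveAtMost H k → LinesHaveAtMost H′ k
  linesHaveAtMost-resp H≤k u v u≢v = subst (λ S → ∣ S ∣ ≤ _) (line-resp u v) (H≤k u v u≢v)

-- Lines depend only on the set of edges, so finitely many hypergraphs need be compared.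
m-exists : ∀ {n k} (H : Hypergraph n) → LinesHaveAtMost H k →
           ∃[ ℓ ] ((m[ n , k ]≡ ℓ) × ℓ ≤ numberOfLines H)
m-exists {n} {k} H₀ H₀≤k =
  numberOfLines best , ((best , best≤k , refl) , minimal) , minimal H₀ H₀≤k
  where
  candidates : List (Hypergraph n)
  candidates = filter (λ H → linesHaveAtMost? H k) (sublists (allSubsets n))
  best : Hypergraph n
  -- The starting value `H₀` satisfies the size bound too, so the minimiser does in every case.
  best = argmin numberOfLines H₀ candidates
  best≤k : LinesHaveAtMost best k
  best≤k = argmin-all numberOfLines H₀≤k (all-filter (λ H → linesHaveAtMost? H k) (sublists (allSubsets n)))
  minimal : ∀ H → LinesHaveAtMost H k → numberOfLines best ≤ numberOfLines H
  minimal H H≤k = ℕ.≤-trans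
    (All.lookup (f[argmin]≤f[xs] {f = numberOfLines} H₀ candidates)
      (∈-filter⁺ _ (filter-∈-sublists (_∈H?) (allSubsets n)) (linesHaveAtMost-resp H⊆H′ H′⊆H H≤k)))
    (ℕ.≤-reflexive (sym (numberOfLines-resp H⊆H′ H′⊆H)))
    where
    open import Data.List.Membership.DecPropositional (Vec.≡-dec Bool._≟_) using (_∈?_)
    _∈H? : Decidable (_∈ˡ H)
    T ∈H? = T ∈? H
    H′ : Hypergraph n
    -- The canonical form of `H`: the same edges, listed in the order of `allSubsets n`, hence a
    -- member of `sublists (allSubsets n)`.
    H′ = filter _∈H? (allSubsets n)
    H⊆H′ : ∀ {T} → T ∈ˡ H → T ∈ˡ H′
    H⊆H′ {T} T∈H = ∈-filter⁺ _∈H? (∈-allSubsets T) T∈H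
    H′⊆H : ∀ {T} → T ∈ˡ H′ → T ∈ˡ H
    H′⊆H T∈H′ = proj₂ (∈-filter⁻ _∈H? {xs = allSubsets n} T∈H′)

-- The hypergraph of coordinates and words.

another : ∀ {k} → 2 ≤ k → (t : Fin k) → ∃[ s ] s ≢ t
another (s≤s (s≤s _)) zero    = suc zero , λ ()
another (s≤s (s≤s _)) (suc t) = zero , λ ()

-- The vertices `t ↑ˡ r` are the coordinates and the vertices `k ↑ʳ y` the words; `coordinates`,
-- `words` and `fibre t a` are the edges T, Y and E(t,a).
module Construction {k q r} (word : Fin r → Fin k → Fin q) where

  agree? : ∀ y y′ → Decidable (λ t → word y t ≡ word y′ t)
  agree? y y′ t = word y t Fin.≟ word y′ t

  letter? : ∀ t a → Decidable (λ y → word y t ≡ a)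
  letter? t a y = word y t Fin.≟ a

  coordinates words : Subset (k + r)
  coordinates = ⊤ {k} ++ ⊥
  words       = ⊥ {k} ++ ⊤

  fibre : Fin k → Fin q → Subset (k + r)
  fibre t a = ⁅ t ⁆ ++ tabulate (does ∘ letter? t a)

  agreement : Subset k → Subset (k + r)
  agreement A = A ++ ⊤

  fibres : List (Subset (k + r))
  fibres = map (uncurry fibre) (cartesianProduct (allFin k) (allFin q))

  hypergraph : Hypergraph (k + r)
  hypergraph = coordinates ∷ words ∷ fibres

  fibre∈fibres : ∀ t a → fibre t a ∈ˡ fibres
  fibre∈fibres t a = ∈-map⁺ (uncurry fibre) (∈-cartesianProduct⁺ (∈-allFin t) (∈-allFin a))

  left∈coordinates : ∀ t → (t ↑ˡ r) ∈ coordinates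
  left∈coordinates t = ↑ˡ∈++⁺ ⊤ ⊥ Subset.∈⊤

  right∉coordinates : ∀ {y} → (k ↑ʳ y) ∉ coordinates
  right∉coordinates = Subset.∉⊥ ∘ ↑ʳ∈++⁻ (⊤ {k}) ⊥

  left∉words : ∀ {t} → (t ↑ˡ r) ∉ words
  left∉words = Subset.∉⊥ ∘ ↑ˡ∈++⁻ ⊥ ⊤

  right∈agreement : ∀ {A} y → (k ↑ʳ y) ∈ agreement A
  right∈agreement {A} y = ↑ʳ∈++⁺ A ⊤ Subset.∈⊤

  left∈fibre⁻ : ∀ {t a s} → (s ↑ˡ r) ∈ fibre t a → s ≡ t
  left∈fibre⁻ {t} {a} = Subset.x∈⁅y⁆⇒x≡y _ ∘ ↑ˡ∈++⁻ ⁅ t ⁆ (tabulate (does ∘ letter? t a))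

  left∈fibre : ∀ t a → (t ↑ˡ r) ∈ fibre t a
  left∈fibre t a = ↑ˡ∈++⁺ ⁅ t ⁆ (tabulate (does ∘ letter? t a)) (Subset.x∈⁅x⁆ t)

  right∈fibre⁻ : ∀ {t a y} → (k ↑ʳ y) ∈ fibre t a → word y t ≡ a
  right∈fibre⁻ {t} {a} = ∈-tabulate⁻ (letter? t a) ∘ ↑ʳ∈++⁻ ⁅ t ⁆ (tabulate (does ∘ letter? t a))

  right∈fibre : ∀ {t a y} → word y t ≡ a → (k ↑ʳ y) ∈ fibre t a
  right∈fibre {t} {a} eq = ↑ʳ∈++⁺ ⁅ t ⁆ (tabulate (does ∘ letter? t a)) (∈-tabulate⁺ (letter? t a) eq)

  edge-cases : ∀ {T} → T ∈ˡ hypergraph → T ≡ coordinates ⊎ T ≡ words ⊎ ∃[ t ] ∃[ a ] T ≡ fibre t a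
  edge-cases (here refl)          = inj₁ refl
  edge-cases (there (here refl))  = inj₂ (inj₁ refl)
  edge-cases (there (there T∈)) = let (t , a) , _ , T≡ = ∈-map⁻ (uncurry fibre) T∈ in inj₂ (inj₂ (t , a , T≡))

  through : ∀ {u v p T} → T ∈ˡ hypergraph → u ∈ T → v ∈ T → p ∈ T → OnLine hypergraph u v p
  through T∈ u∈ v∈ p∈ = inj₂ (lose T∈ (u∈ , v∈ , p∈))

  -- T is the only edge with two coordinates: Y has none and each fibre exactly one.
  line-left-left : ∀ {t t′} → t ≢ t′ → line hypergraph (t ↑ˡ r) (t′ ↑ˡ r) ≡ coordinates
  line-left-left {t} {t′} t≢t′ = line≡ hypergraph (left∈coordinates t) (left∈coordinates t′) coll⇒∈
    (through (here refl) (left∈coordinates t) (left∈coordinates t′))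
    where
    coll⇒∈ : ∀ {p} → Collinear hypergraph (t ↑ˡ r) (t′ ↑ˡ r) p → p ∈ coordinates
    coll⇒∈ coll with find coll
    ... | T , T∈ , t∈ , t′∈ , p∈ with edge-cases T∈
    ... | inj₁ refl                   = p∈
    ... | inj₂ (inj₁ refl)            = contradiction t∈ left∉words
    ... | inj₂ (inj₂ (s , a , refl)) = contradiction (trans (left∈fibre⁻ t∈) (sym (left∈fibre⁻ t′∈))) t≢t′

  -- T contains no word and Y no coordinate. A fibre through the coordinate `t` is some E(t,a), and
  -- it contains `y` only if a is the letter of `y` at `t`.
  line-left-right : ∀ t y → line hypergraph (t ↑ˡ r) (k ↑ʳ y) ≡ fibre t (word y t)
  line-left-right t y = line≡ hypergraph (left∈fibre t (word y t)) (right∈fibre refl) coll⇒∈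
    (through (there (there (fibre∈fibres t (word y t)))) (left∈fibre t (word y t)) (right∈fibre refl))
    where
    coll⇒∈ : ∀ {p} → Collinear hypergraph (t ↑ˡ r) (k ↑ʳ y) p → p ∈ fibre t (word y t)
    coll⇒∈ coll with find coll
    ... | T , T∈ , t∈ , y∈ , p∈ with edge-cases T∈
    ... | inj₁ refl                   = contradiction y∈ right∉coordinates
    ... | inj₂ (inj₁ refl)            = contradiction t∈ left∉words
    ... | inj₂ (inj₂ (s , a , refl)) with left∈fibre⁻ t∈ | right∈fibre⁻ y∈
    ...   | refl | refl = p∈

  -- The edges shared by the two words are Y and the fibres E(t,a) where both have letter a at t.
  -- The former contributes all words, each of the latter its one coordinate t.
  line-right-right : ∀ y y′ → line hypergraph (k ↑ʳ y) (k ↑ʳ y′) ≡ agreement (tabulate (does ∘ agree? y y′))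
  line-right-right y y′ = line≡ hypergraph (right∈agreement y) (right∈agreement y′) coll⇒∈ ∈⇒onLine
    where
    A : Subset k
    A = tabulate (does ∘ agree? y y′)
    coll⇒∈ : ∀ {p} → Collinear hypergraph (k ↑ʳ y) (k ↑ʳ y′) p → p ∈ agreement A
    coll⇒∈ {p} coll with side k p | find coll
    ... | right z | _ = right∈agreement z
    ... | left t  | T , T∈ , y∈ , y′∈ , t∈ with edge-cases T∈
    ...   | inj₁ refl                   = contradiction y∈ right∉coordinates
    ...   | inj₂ (inj₁ refl)            = contradiction t∈ left∉words
    ...   | inj₂ (inj₂ (s , a , refl)) with left∈fibre⁻ t∈
    ...     | refl = ↑ˡ∈++⁺ A ⊤ (∈-tabulate⁺ (agree? y y′) (trans (right∈fibre⁻ y∈) (sym (right∈fibre⁻ y′∈))))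
    ∈⇒onLine : ∀ {p} → p ∈ agreement A → OnLine hypergraph (k ↑ʳ y) (k ↑ʳ y′) p
    ∈⇒onLine {p} p∈ with side k p
    ... | right z = through (there (here refl)) (right∈agreement y) (right∈agreement y′) (right∈agreement z)
    ... | left t  = through (there (there (fibre∈fibres t (word y t)))) (right∈fibre refl)
      (right∈fibre (sym (∈-tabulate⁻ (agree? y y′) (↑ˡ∈++⁻ A ⊤ p∈)))) (left∈fibre t (word y t))

  -- All 2^k candidates A ∪ Y are listed, whether or not A arises as the agreement set of two words.
  lineList : List (Subset (k + r))
  lineList = coordinates ∷ fibres List.++ map agreement (allSubsets k)

  line∈lineList : ∀ u v → u ≢ v → line hypergraph u v ∈ˡ lineList
  line∈lineList u v u≢v with side k u | side k v
  ... | left t  | left t′  = here (line-left-left (u≢v ∘ cong (_↑ˡ r)))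
  ... | left t  | right y  = there (∈-++⁺ˡ (subst (_∈ˡ fibres) (sym (line-left-right t y)) (fibre∈fibres t (word y t))))
  ... | right y | left t   = there (∈-++⁺ˡ (subst (_∈ˡ fibres)
                               (sym (trans (line-comm hypergraph (k ↑ʳ y) (t ↑ˡ r)) (line-left-right t y))) (fibre∈fibres t (word y t))))
  ... | right y | right y′ = there (∈-++⁺ʳ fibres (subst (_∈ˡ map agreement (allSubsets k))
                               (sym (line-right-right y y′)) (∈-map⁺ agreement (∈-allSubsets (tabulate (does ∘ agree? y y′))))))

  numberOfLines-bound : numberOfLines hypergraph ≤ suc (k * q + 2 ^ k)
  numberOfLines-bound = ℕ.≤-trans (numberOfLines≤ hypergraph line∈lineList) (ℕ.≤-reflexive (cong suc
    (trans (List.length-++ fibres) (cong₂ _+_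
      (trans (List.length-map (uncurry fibre) (cartesianProduct (allFin k) (allFin q)))
        (trans (length-cartesianProduct (allFin k) (allFin q))
          (cong₂ _*_ (List.length-tabulate {n = k} _) (List.length-tabulate {n = q} _))))
      (trans (List.length-map agreement (allSubsets k)) (length-allSubsets k))))))

  module _ (2≤k : 2 ≤ k) (y₀ : Fin r) (separated : ∀ {y y′} → y ≢ y′ → ∃[ t ] word y t ≢ word y′ t) where

    fibre-avoids : ∀ t a → ∃[ p ] p ∉ fibre t a
    fibre-avoids t a = let s , s≢t = another 2≤k t in s ↑ˡ r , s≢t ∘ left∈fibre⁻

    -- T misses the word `y₀`, a fibre misses every coordinate but its own, and the line through two
    -- words misses a coordinate at which they differ.
    line-avoids : ∀ u v → u ≢ v → ∃[ p ] p ∉ line hypergraph u v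
    line-avoids u v u≢v with side k u | side k v
    ... | left t  | left t′  = k ↑ʳ y₀ , subst ((k ↑ʳ y₀) ∉_) (sym (line-left-left (u≢v ∘ cong (_↑ˡ r)))) right∉coordinates
    ... | left t  | right y  = subst (λ S → ∃[ p ] p ∉ S) (sym (line-left-right t y)) (fibre-avoids t (word y t))
    ... | right y | left t   = subst (λ S → ∃[ p ] p ∉ S)
      (sym (trans (line-comm hypergraph (k ↑ʳ y) (t ↑ˡ r)) (line-left-right t y))) (fibre-avoids t (word y t))
    ... | right y | right y′ = let t , t-separates = separated (u≢v ∘ cong (k ↑ʳ_)) in
      t ↑ˡ r , subst ((t ↑ˡ r) ∉_) (sym (line-right-right y y′))
        (t-separates ∘ ∈-tabulate⁻ (agree? y y′) ∘ ↑ˡ∈++⁻ (tabulate (does ∘ agree? y y′)) ⊤)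

    linesHaveAtMost : LinesHaveAtMost hypergraph ((k + r) ∸ 1)
    linesHaveAtMost u v u≢v = ∉⇒∣∣≤n∸1 (proj₂ (line-avoids u v u≢v))

-- Choice of the words and of the parameters.

funToFin-cong : ∀ {m n} {f g : Fin m → Fin n} → (∀ i → f i ≡ g i) → funToFin f ≡ funToFin g
funToFin-cong {zero}  f≗g = refl
funToFin-cong {suc m} f≗g = cong₂ combine (f≗g zero) (funToFin-cong (f≗g ∘ suc))

-- `finToFun` lists the digits of a number in base `q`; if all digits agreed, `funToFin` would
-- recover the same number from both.
finToFun-separates : ∀ {k q} {i j : Fin (q ^ k)} → i ≢ j → ∃[ t ] finToFun {q} {k} i t ≢ finToFun j t
finToFun-separates {k} {q} {i} {j} i≢j =
  Fin.¬∀⟶∃¬ k _ (λ t → finToFun {q} {k} i t Fin.≟ finToFun j t) λ same →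
    i≢j (trans (sym (Fin.funToFin-finToFin {k} {q} i)) (trans (funToFin-cong same) (Fin.funToFin-finToFin {k} {q} j)))

few-lines : ∀ {n k q} → 2 ≤ k → k < n → n ≤ q ^ k →
            ∃[ H ] (LinesHaveAtMost {n} H (n ∸ 1) × numberOfLines H ≤ suc (k * q + 2 ^ k))
few-lines {n} {k} {q} 2≤k k<n n≤qᵏ with ℕ.m≤n⇒∃[o]m+o≡n k<n
-- Here n = k + 1 + r: there are r + 1 words besides the k coordinates, and `zero` serves as the
-- word missed by T.
... | r , refl = subst (λ n → ∃[ H ] (LinesHaveAtMost {n} H (n ∸ 1) × numberOfLines H ≤ suc (k * q + 2 ^ k)))
    (ℕ.+-suc k r) (hypergraph , linesHaveAtMost 2≤k zero separated , numberOfLines-bound)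
  where
  r<qᵏ : suc r ≤ q ^ k
  r<qᵏ = ℕ.≤-trans (s≤s (ℕ.m≤n+m r k)) n≤qᵏ
  open Construction (λ y → finToFun {q} {k} (inject≤ y r<qᵏ))
  separated : ∀ {y y′ : Fin (suc r)} → y ≢ y′ → ∃[ t ] finToFun {q} {k} (inject≤ y r<qᵏ) t ≢ finToFun (inject≤ y′ r<qᵏ) t
  separated y≢y′ = finToFun-separates (y≢y′ ∘ Fin.inject≤-injective r<qᵏ r<qᵏ _ _)

-- With k = i + 2 the intervals from 2^((k-1)²), excluded, to 2^(k²), included, tile the integers
-- from 3 on; by induction the successor stays in the same interval or enters the next.
dyadic-square : ∀ n → 3 ≤ n → ∃[ i ] (2 ^ (suc i * suc i) < n × n ≤ 2 ^ (suc (suc i) * suc (suc i)))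
dyadic-square zero    ()
dyadic-square (suc n) 3≤1+n with ℕ.m≤n⇒m<n∨m≡n 3≤1+n
-- The first value: 2 < 3 ≤ 16 = 3 + 13.
... | inj₂ refl = 0 , ℕ.≤-refl , ℕ.m≤m+n 3 13
... | inj₁ (s≤s 3≤n) with dyadic-square n 3≤n
...   | i , lo , hi with ℕ.m≤n⇒m<n∨m≡n hi
...     | inj₁ n<hi = i , ℕ.m≤n⇒m≤1+n lo , n<hi
-- `n` is the right end of its interval, so `suc n` is the first element of the next one.
...     | inj₂ n≡hi = suc i , s≤s (ℕ.≤-reflexive (sym n≡hi)) ,
  ℕ.≤-trans (s≤s (ℕ.≤-reflexive n≡hi))
    (ℕ.^-monoʳ-< 2 ℕ.≤-refl (ℕ.*-mono-< (ℕ.n<1+n (2 + i)) (ℕ.n<1+n (2 + i))))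

n<2^n : ∀ n → n < 2 ^ n
n<2^n zero    = ℕ.≤-refl
n<2^n (suc n) = ℕ.+-mono-≤-< (ℕ.m^n>0 2 n) (subst (n <_) (sym (ℕ.+-identityʳ _)) (n<2^n n))

-- The left side is the bound of `few-lines` for q = 2^k. As k + 1 ≤ 2^k, it is at most 1 + 2^(2k),
-- and the 1 is absorbed by doubling.
count≤power : ∀ k → suc (k * 2 ^ k + 2 ^ k) ≤ 2 ^ suc (k + k)
count≤power k = begin
  suc (k * 2 ^ k + 2 ^ k)           ≡⟨ cong suc (ℕ.+-comm (k * 2 ^ k) (2 ^ k)) ⟩
  suc (suc k * 2 ^ k)                   ≤⟨ s≤s (ℕ.*-monoˡ-≤ (2 ^ k) (n<2^n k)) ⟩
  suc (2 ^ k * 2 ^ k)                 ≡⟨ cong suc (ℕ.^-distribˡ-+-* 2 k k) ⟨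
  1 + 2 ^ (k + k)                     ≤⟨ ℕ.+-mono-≤ (ℕ.m^n>0 2 (k + k)) (ℕ.m≤m+n _ 0) ⟩
  2 ^ suc (k + k)                       ∎
  where open ℕ.≤-Reasoning

-- Natural numbers and powers of two among the rationals.

ι-+ : ∀ m n → ι (m + n) ≡ ι m ℚ.+ ι n
ι-+ zero    n = sym (ℚ.+-identityˡ (ι n))
ι-+ (suc m) n = trans (ι-suc (m + n)) (trans (cong (1ℚ ℚ.+_) (ι-+ m n))
  (trans (sym (ℚ.+-assoc 1ℚ (ι m) (ι n))) (cong (ℚ._+ ι n) (sym (ι-suc m)))))

ι-* : ∀ m n → ι (m * n) ≡ ι m ℚ.* ι n
ι-* zero    n = sym (ℚ.*-zeroˡ (ι n))
ι-* (suc m) n = trans (ι-+ n (m * n)) (trans (cong (ι n ℚ.+_) (ι-* m n))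
  (trans (solve 2 (λ m n → n :+ m :* n := (con 1ℚ :+ m) :* n) refl (ι m) (ι n))
    (cong (ℚ._* ι n) (sym (ι-suc m)))))
  where open ℚ.+-*-Solver

ι-mono-< : ∀ {m n} → m < n → ι m ℚ.< ι n
ι-mono-< {m} {n} m<n = ℚ.<-≤-trans
  (subst₂ ℚ._<_ (ℚ.+-identityˡ (ι m)) (sym (ι-suc m)) (ℚ.+-monoˡ-< (ι m) 0<1))
  (ι-mono m<n)

ι-cancel-< : ∀ {m n} → ι m ℚ.< ι n → m < n
ι-cancel-< ιm<ιn = ℕ.≰⇒> λ n≤m → ℚ.<-irrefl refl (ℚ.<-≤-trans ιm<ιn (ι-mono n≤m))

ι-2^ : ∀ n → ι (2 ^ n) ≡ (1ℚ ℚ.+ 1ℚ) ^ℚ n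
ι-2^ zero    = refl
ι-2^ (suc n) = trans (ι-* 2 (2 ^ n)) (cong ((1ℚ ℚ.+ 1ℚ) ℚ.*_) (ι-2^ n))

ι-2^*½^ : ∀ n → ι (2 ^ n) ℚ.* ½ ^ℚ n ≡ 1ℚ
ι-2^*½^ n = trans (cong (ℚ._* ½ ^ℚ n) (ι-2^ n)) (2^*½^ n)
  where
  open ℚ.+-*-Solver
  2^*½^ : ∀ n → (1ℚ ℚ.+ 1ℚ) ^ℚ n ℚ.* ½ ^ℚ n ≡ 1ℚ
  2^*½^ zero    = refl
  2^*½^ (suc n) = trans
    (solve 2 (λ x y → con (1ℚ ℚ.+ 1ℚ) :* x :* (con ½ :* y) := x :* y) refl ((1ℚ ℚ.+ 1ℚ) ^ℚ n) (½ ^ℚ n))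
    (2^*½^ n)

-- Lower bounds for exponentials, logarithms, products and roots.

0<½ : 0ℚ ℚ.< ½
0<½ = ℚ.positive⁻¹ ½

-- For p = K = k + 1 the lower bound (1 + p/K)^K of exp p is exactly 2^K.
exp-ι>2^ : ∀ k {q} → q ℚ.< ι (2 ^ suc k) → q <exp ι (suc k)
exp-ι>2^ k {q} q<2^ = k , subst (0ℚ ℚ.<_) (sym base) (0<+ 0<1 0<1) ,
  subst (q ℚ.<_) (trans (ι-2^ (suc k)) (cong (_^ℚ suc k) (sym base))) q<2^
  where
  base : lowerBase (ι (suc k)) k ≡ 1ℚ ℚ.+ 1ℚ
  base = cong (1ℚ ℚ.+_) (ι*recip k)

-- For p = K/2 with K = k + 1 the upper bound (1 - p/K)^(-K) of exp p is exactly 2^K. This is the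
-- estimate ln 2 ≥ 1/2 in exponential form.
exp-half<2^ : ∀ k {q} → ι (2 ^ suc k) ℚ.< q → (ι (suc k) ℚ.* ½) exp< q
exp-half<2^ k {q} 2^<q = k , subst (0ℚ ℚ.<_) (sym base) 0<½ ,
  subst₂ ℚ._<_ (ι-2^*½^ (suc k)) (cong (λ b → q ℚ.* b ^ℚ suc k) (sym base))
    (*ʳ-< (^-pos (suc k) 0<½) 2^<q)
  where
  open ℚ.+-*-Solver
  base : upperBase (ι (suc k) ℚ.* ½) k ≡ ½
  base = trans
    (solve 2 (λ m r → con 1ℚ :- m :* con ½ :* r := con 1ℚ :- con ½ :* (m :* r)) refl (ι (suc k)) (recip k))
    (cong (λ z → 1ℚ ℚ.- ½ ℚ.* z) (ι*recip k))

lower-ln : ∀ x k {q} → lower (proj₁ x) (ι (2 ^ suc k)) → q ℚ.< ι (suc k) ℚ.* ½ → lower (ln x) q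
-- Openness of the cut gives `s` strictly between 2^(k+1) and x, as the strict bound in
-- `exp-half<2^` requires.
lower-ln x k 2^<x q<k/2 = let s , 2^<s , s<x = lower-open (proj₁ x) 2^<x in
  s , (ι (suc k) ℚ.* ½ , q<k/2 , exp-half<2^ k 2^<s) , s<x

-- For positive lower ends, `a * c` is the least corner product of a box whatever its upper ends
-- are.
lower-*ℝ : ∀ {x y a c q} → 0ℚ ℚ.< a → 0ℚ ℚ.< c → lower x a → lower y c → q ℚ.< a ℚ.* c → lower (x *ℝ y) q
lower-*ℝ {x} {y} {a} {c} 0<a 0<c a<x c<y q<ac =
  let b , x<b = upper-inhabited x
      d , y<d = upper-inhabited y
      a≤b     = ℚ.<⇒≤ (lower<upper x a<x x<b)
      c≤d     = ℚ.<⇒≤ (lower<upper y c<y y<d)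
      ac≤bc   = *ʳ-≤ (ℚ.<⇒≤ 0<c) a≤b
  in record { a<x = a<x ; x<b = x<b ; c<y = c<y ; y<d = y<d } ,
     <⊓ (<⊓ q<ac (ℚ.<-≤-trans q<ac (*ˡ-≤ (ℚ.<⇒≤ 0<a) c≤d)))
        (<⊓ (ℚ.<-≤-trans q<ac ac≤bc)
            (ℚ.<-≤-trans q<ac (ℚ.≤-trans ac≤bc (*ˡ-≤ (ℚ.≤-trans (ℚ.<⇒≤ 0<a) a≤b) c≤d))))

-- Placing x/2 below a square root of at least x²/2 takes a witness s with x/2 < s and s² < x²/2.
-- The choice s = 2x/3 works because 1/2 < 2/3 and 4/9 < 1/2.
x/2<2x/3 : ∀ {x} → 0ℚ ℚ.< x → x ℚ.* ½ ℚ.< x ℚ.* (+ 2 ℚ./ 3)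
x/2<2x/3 0<x = *ˡ-< 0<x (0<q-p⇒p<q (ℚ.positive⁻¹ ((+ 2 ℚ./ 3) ℚ.- ½)))

[2x/3]²<x²/2 : ∀ {x} → 0ℚ ℚ.< x → x ℚ.* (+ 2 ℚ./ 3) ℚ.* (x ℚ.* (+ 2 ℚ./ 3)) ℚ.< x ℚ.* x ℚ.* ½
[2x/3]²<x²/2 {x} 0<x = 0<q-p⇒p<q (subst (0ℚ ℚ.<_)
  -- The gap is 1/2 - 4/9 = 1/18 of x².
  (solve 1 (λ x → x :* x :* con (+ 1 ℚ./ 18)
    := x :* x :* con ½ :- x :* con (+ 2 ℚ./ 3) :* (x :* con (+ 2 ℚ./ 3))) refl x)
  (0<* (0<* 0<x 0<x) (ℚ.positive⁻¹ (+ 1 ℚ./ 18))))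
  where open ℚ.+-*-Solver

5+2y<6+6y : ∀ {y} → 0ℚ ℚ.≤ y → ι 5 ℚ.+ (y ℚ.+ y) ℚ.< (1ℚ ℚ.+ y) ℚ.* ½ ℚ.* ι 12
5+2y<6+6y {y} 0≤y = 0<q-p⇒p<q (subst (0ℚ ℚ.<_)
  (solve 1 (λ y → con 1ℚ :+ con (ι 4) :* y
    := (con 1ℚ :+ y) :* con ½ :* con (ι 12) :- (con (ι 5) :+ (y :+ y))) refl y)
  (0<+0≤ 0<1 (0≤* (0≤ι 4) 0≤y)))
  where open ℚ.+-*-Solver

-- Comparison of 2^(2k+1) with a power of exponent √(ln n).

lower-fromℕ⁺ : ∀ {m} n .{{_ : NonZero n}} → m < n → lower (proj₁ (fromℕ⁺ n)) (ι m)
lower-fromℕ⁺ (suc _) = ι-mono-<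

lower-√ln : ∀ i n .{{_ : NonZero n}} → 2 ^ (suc i * suc i) < n →
            lower (√ (ln (fromℕ⁺ n))) (ι (suc i) ℚ.* ½)
lower-√ln i n 2^<n = ι (suc i) ℚ.* (+ 2 ℚ./ 3) , x/2<2x/3 (0<ιsuc i) ,
  -- `lower-ln` takes the predecessor of the exponent, and `suc i * suc i` reduces to
  -- `suc (i + i * suc i)`.
  inj₂ (lower-ln (fromℕ⁺ n) (i + i * suc i) (lower-fromℕ⁺ n 2^<n)
    (subst (λ z → ι (suc i) ℚ.* (+ 2 ℚ./ 3) ℚ.* (ι (suc i) ℚ.* (+ 2 ℚ./ 3)) ℚ.< z ℚ.* ½)
      (sym (ι-* (suc i) (suc i))) ([2x/3]²<x²/2 (0<ιsuc i))))

-- Here k = i + 2. As ln 2 > 1/2, the number x/2 with x = k - 1 lies below √(x²/2) ≤ √(ln n);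
-- 12 is chosen so that the exponent 2k + 1 = 5 + 2i stays below 12 · x/2.
2^≤^ℝ : ∀ {c y} i → lower (ln c) (ι 12) → lower y (ι (suc i) ℚ.* ½) →
        fromℕ (2 ^ (5 + (i + i))) ≤ℝ (c ^ℝ y)
2^≤^ℝ {c} {y} i 12<ln a<y q q<2^ = ι (5 + (i + i)) ,
  lower-*ℝ {y} {ln c} (0<* (0<ιsuc i) 0<½) (0<ιsuc 11) a<y 12<ln
    (subst₂ ℚ._<_ (sym (trans (ι-+ 5 (i + i)) (cong (ι 5 ℚ.+_) (ι-+ i i))))
      (cong (λ z → z ℚ.* ½ ℚ.* ι 12) (sym (ι-suc i))) (5+2y<6+6y (0≤ι i))) ,
  exp-ι>2^ (4 + (i + i)) q<2^

theorem3 : Σ[ n₀ ∈ ℝ⁺ ] Σ[ c ∈ ℝ⁺ ]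
    (∀ (n : ℕ) .{{_ : NonZero n}} → proj₁ n₀ ≤ℝ fromℕ n →
    ∃[ ℓ ] (m[ n , n ∸ 1 ]≡ ℓ) × (fromℕ ℓ ≤ℝ (c ^ℝ (√ (ln (fromℕ⁺ n))))))
theorem3 = fromℕ⁺ 3 , c , bound
  where
  c : ℝ⁺
  -- Chosen so that ln c > 12: from 2^25 < c follows ln c ≥ 25/2.
  c = fromℕ⁺ (2 ^ 26)

  12<lnc : lower (ln c) (ι 12)
  12<lnc = lower-ln c 24 (lower-fromℕ⁺ (2 ^ 26) (ℕ.^-monoʳ-< 2 ℕ.≤-refl (ℕ.n<1+n 25)))
    (0<q-p⇒p<q (ℚ.positive⁻¹ (ι 25 ℚ.* ½ ℚ.- ι 12)))

  bound : ∀ (n : ℕ) .{{_ : NonZero n}} → fromℕ 3 ≤ℝ fromℕ n →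
          ∃[ ℓ ] (m[ n , n ∸ 1 ]≡ ℓ) × (fromℕ ℓ ≤ℝ (c ^ℝ (√ (ln (fromℕ⁺ n)))))
  bound n 3≤n =
    -- The inequality of cuts is evaluated at the rational 2: from 2 < 3 follows 2 < n, which is 3 ≤
    -- n.
    let i , lo , hi        = dyadic-square n (ι-cancel-< {2} (3≤n (ι 2) (ι-mono-< {2} {3} ℕ.≤-refl)))
        k                  = 2 + i
        -- k = i + 2 ≤ 2^(i+1) ≤ 2^((i+1)²) < n.
        k<n                = ℕ.≤-<-trans (ℕ.≤-trans (n<2^n (suc i)) (ℕ.^-monoʳ-≤ 2 (ℕ.m≤m*n (suc i) (suc i)))) lo
        H , H≤ , H-bound   = few-lines {n} {k} {2 ^ k} (s≤s (s≤s z≤n)) k<n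
                               (ℕ.≤-trans hi (ℕ.≤-reflexive (sym (ℕ.^-*-assoc 2 k k))))
        ℓ , m≡ℓ , ℓ≤       = m-exists H H≤
        ℓ≤2^               = ℕ.≤-trans (ℕ.≤-trans ℓ≤ H-bound) (ℕ.≤-trans (count≤power k)
                               (ℕ.≤-reflexive (cong (λ z → 2 ^ (3 + z)) (trans (ℕ.+-suc i (suc i)) (cong suc (ℕ.+-suc i i))))))
    in ℓ , m≡ℓ , λ q q<ℓ → 2^≤^ℝ {c} {√ (ln (fromℕ⁺ n))} i 12<lnc (lower-√ln i n lo) q (ℚ.<-≤-trans q<ℓ (ι-mono ℓ≤2^))
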